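{- Let $d\ge1$ and $r\ge 1$ be integers and let $\mathcal{F}$ be the $r$-colored barycentric subdivision of $(d-1)$-dimensional simplicial complexes. Then its transformation matrix $H_{\mathcal F}$ (a $(d+1)\times(d+1)$ real matrix) is TP$_2$, i.e. all entries and all $2\times2$ minors of $H_{\mathcal F}$ are non-negative.
   Context: Rows and columns of matrices are indexed starting from $0$. All simplicial complexes are finite. For a $(d-1)$-dimensional simplicial complex $\Delta$ with $f_{i-1}$ faces of dimension $i-1$ ($f_{ -1}=1$), the $h$-vector $h^\Delta=(h_0,\dots,h_d)$ is defined by $\sum_{i=0}^d h_i x^i=\sum_{i=0}^d f_{i-1}x^i(1-x)^{d-i}$. The barycentric subdivision $\mathrm{sd}(\Delta)$ is the simplicial complex of all chains in the poset of nonempty faces of $\Delta$ ordered by inclusion. For a simplicial complex $\Gamma$ with linearly ordered vertices $v_1<\cdots<v_m$, the $r$-fold edgewise subdivision $\mathrm{esd}_r(\Gamma)$ is the simplicial complex whose vertices are the functions $u:\{v_1,\dots,v_m\}\to\mathbb{Z}_{\ge0}$ with $\sum_i u(v_i)=r$ and $\{v_i:u(v_i)\neq0\}\in\Gamma$; a set $E$ of such functions is a face if the union of their supports is a face of $\Gamma$ and, for all $u,w\in E$, $\iota(u)-\iota(w)\in\{0,1\}^m$ or $\iota(w)-\iota(u)\in\{0,1\}^m$, where $\iota(u)=(u(v_1),u(v_1)+u(v_2),\dots,u(v_1)+\cdots+u(v_m))$. (Its face numbers do not depend on the chosen vertex order.) The $r$-colored barycentric subdivision of $\Delta$ is $\mathrm{esd}_r(\mathrm{sd}(\Delta))$.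 The transformation matrix $H_{\mathcal F}$ is the $(d+1)\times(d+1)$ matrix, depending only on $d$ and $r$, such that $h^{\Delta'}=H_{\mathcal F}\,h^{\Delta}$ (column vectors) for every $(d-1)$-dimensional simplicial complex $\Delta$ with $r$-colored barycentric subdivision $\Delta'$. It is known that, explicitly, the generating polynomial $\sum_{i=0}^d H_{\mathcal F}(i,j)x^i$ of the $j$-th column equals $E_r\big[(1+x+\cdots+x^{r-1})^dP_{d,j}(x)\big]$, where $E_r\big[\sum_{k\ge 0} c_kx^k\big]=\sum_{k\ge 0} c_{rk}x^k$ and $P_{d,j}(x)=\sum_{i=0}^d\Big(\sum_{s=0}^{i}s^j(s+1)^{d-j}(-1)^{i-s}\binom{d+1}{i-s}\Big)x^i$ with $0^0=1$. -}

module Defs where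

open import Algebra.Definitions.RawMonoid using (sum)
open import Data.Empty using (⊥-elim)
open import Data.Fin.Base as Fin using (Fin; toℕ)
open import Data.Fin.Properties using (all?; any?)
open import Data.Fin.Subset using (Subset; inside; outside; ⊥; _∈_; _⊆_; ∣_∣)
open import Data.Fin.Subset.Properties using (_∈?_; _⊆?_; nonempty?; ∉⊥)
open import Data.Integer.Base using (+_)
open import Data.List.Base as List using (List; []; _∷_; length; filter; cartesianProductWith; upTo)
open import Data.Nat.Base as ℕ using (ℕ; zero; suc; _≤_; _∸_; _<ᵇ_)
open import Data.Nat.Properties using (_≟_)
open import Data.Product.Base using (∃; _×_; _,_)
open import Data.Rational.Base as ℚ using (ℚ; 0ℚ; 1ℚ)
open import Data.Sum.Base using (_⊎_)
open import Data.Vec.Base as Vec using (Vec; []; _∷_; lookup; tabulate)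
open import Data.Vec.Functional using (Vector)
open import Data.Vec.Properties using (lookup⇒[]=; []=⇒lookup; lookup∘tabulate)
open import Data.Vec.Relation.Binary.Pointwise.Inductive as Pointwise using (Pointwise)
open import Relation.Binary.PropositionalEquality using (_≡_; sym; trans)
open import Relation.Nullary.Decidable using (Dec; does; yes; no; _×-dec_; _⊎-dec_; _→-dec_; dec-true)
open import Relation.Unary using (Decidable)

private
  variable
    A : Set
    m n : ℕ

vectors : List A → (n : ℕ) → List (Vec A n)
vectors xs zero    = [] ∷ []
vectors xs (suc n) = cartesianProductWith _∷_ xs (vectors xs n)

subsets : (n : ℕ) → List (Subset n)
subsets = vectors (outside ∷ inside ∷ [])

-- The ground set is Fin ground, with its usual linear order; its vertices
-- are those v for which ⁅ v ⁆ is a face (other elements of the ground set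
-- lie in no face and play no role).

record SimplicialComplex : Set₁ where
  field
    ground : ℕ
    Face   : Subset ground → Set
    face?  : Decidable Face
    ⊥-face : Face ⊥
    closed : ∀ {S T} → S ⊆ T → Face T → Face S

open SimplicialComplex public

HasDim+1 : SimplicialComplex → ℕ → Set
HasDim+1 Δ d = (∃ λ S → Face Δ S × ∣ S ∣ ≡ d) × (∀ S → Face Δ S → ∣ S ∣ ≤ d)

-- faceCount Δ i is f_{i-1}: the index is the cardinality, not the dimension.

faceCount : SimplicialComplex → ℕ → ℕ
faceCount Δ i =
  length (filter (λ S → face? Δ S ×-dec (∣ S ∣ ≟ i)) (subsets (ground Δ)))

-- A polynomial is given by its sequence of coefficients.

Poly : Set
Poly = ℕ → ℚ

1ₚ : Poly
1ₚ zero    = 1ℚ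
1ₚ (suc _) = 0ℚ

x·_ : Poly → Poly
(x· p) zero    = 0ℚ
(x· p) (suc k) = p k

[1-x]·_ : Poly → Poly
([1-x]· p) k = p k ℚ.- (x· p) k

x^_·[1-x]^_ : ℕ → ℕ → Poly
x^ zero  ·[1-x]^ zero  = 1ₚ
x^ zero  ·[1-x]^ suc b = [1-x]· (x^ zero ·[1-x]^ b)
x^ suc a ·[1-x]^ b     = x· (x^ a ·[1-x]^ b)

∑ : Vector ℚ n → ℚ
∑ = sum ℚ.+-0-rawMonoid

fromℕ : ℕ → ℚ
fromℕ k = + k ℚ./ 1

-- The coefficients of ∑ᵢ f_{i-1} xⁱ (1 - x)^{d-i}; this is the h-vector of Δ
-- when Δ has dimension d - 1.

hVector : (d : ℕ) → SimplicialComplex → Vector ℚ (suc d)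
hVector d Δ k =
  ∑ {suc d} λ i → fromℕ (faceCount Δ (toℕ i)) ℚ.* (x^ toℕ i ·[1-x]^ (d ∸ toℕ i)) (toℕ k)

-- The vertices of sd Δ are the nonempty faces of Δ, in the order in which
-- they are enumerated by  subsets ; this order is the one used by esd below.
-- (Another order would give the same face numbers.)

nonemptyFaces : (Δ : SimplicialComplex) → List (Subset (ground Δ))
nonemptyFaces Δ = filter (λ S → face? Δ S ×-dec nonempty? S) (subsets (ground Δ))

Comparable : Subset n → Subset n → Set
Comparable S T = S ⊆ T ⊎ T ⊆ S

sd : SimplicialComplex → SimplicialComplex
sd Δ = record
  { ground = length L
  ; Face   = λ C → ∀ i j → i ∈ C → j ∈ C → Comparable (List.lookup L i) (List.lookup L j)
  ; face?  = λ C → all? λ i → all? λ j → (i ∈? C) →-dec ((j ∈? C) →-dec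
               ((List.lookup L i ⊆? List.lookup L j) ⊎-dec (List.lookup L j ⊆? List.lookup L i)))
  ; ⊥-face = λ i j i∈⊥ _ → ⊥-elim (∉⊥ i∈⊥)
  ; closed = λ S⊆T chain i j i∈S j∈S → chain i j (S⊆T i∈S) (S⊆T j∈S)
  }
  where
  L = nonemptyFaces Δ

support : Vec ℕ n → Subset n
support = Vec.map (0 <ᵇ_)

ι : Vec ℕ n → Vec ℕ n
ι []      = []
ι (a ∷ u) = a ∷ Vec.map (a ℕ.+_) (ι u)

-- a -01- b  says that the vector a - b lies in {0,1}ⁿ.

_-01-_ : Vec ℕ n → Vec ℕ n → Set
_-01-_ = Pointwise (λ a b → a ≡ b ⊎ a ≡ suc b)

_-01?-_ : (a b : Vec ℕ n) → Dec (a -01- b)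
_-01?-_ = Pointwise.decidable (λ a b → (a ≟ b) ⊎-dec (a ≟ suc b))

Close : Vec ℕ n → Vec ℕ n → Set
Close u w = ι u -01- ι w ⊎ ι w -01- ι u

esdVertices : ℕ → (Γ : SimplicialComplex) → List (Vec ℕ (ground Γ))
esdVertices r Γ =
  filter (λ u → (Vec.sum u ≟ r) ×-dec face? Γ (support u)) (vectors (upTo (suc r)) (ground Γ))

-- The union of the supports of the members of a set E of vectors, where E is
-- given as a set of positions in the list L.

supportUnion : (L : List (Vec ℕ n)) → Subset (length L) → Subset n
supportUnion L E = tabulate λ v → does (any? λ i → (i ∈? E) ×-dec (v ∈? support (List.lookup L i)))

module _ (L : List (Vec ℕ n)) where

  ∈-supportUnion⁺ : ∀ {E v} → (∃ λ i → i ∈ E × v ∈ support (List.lookup L i)) → v ∈ supportUnion L E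
  ∈-supportUnion⁺ {E} {v} p =
    lookup⇒[]= v _ (trans (lookup∘tabulate _ v) (dec-true (any? _) p))

  ∈-supportUnion⁻ : ∀ {E v} → v ∈ supportUnion L E → ∃ λ i → i ∈ E × v ∈ support (List.lookup L i)
  ∈-supportUnion⁻ {E} {v} v∈
    with any? (λ i → (i ∈? E) ×-dec (v ∈? support (List.lookup L i)))
       | trans (sym (lookup∘tabulate _ v)) ([]=⇒lookup v∈)
  ... | yes p | _  = p
  ... | no  _ | ()

  supportUnion-mono : ∀ {E F} → E ⊆ F → supportUnion L E ⊆ supportUnion L F
  supportUnion-mono {E} {F} E⊆F v∈ with ∈-supportUnion⁻ {E} v∈
  ... | i , i∈E , v∈u = ∈-supportUnion⁺ {F} (i , E⊆F i∈E , v∈u)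

  supportUnion-⊥ : supportUnion L ⊥ ⊆ ⊥
  supportUnion-⊥ v∈ with ∈-supportUnion⁻ {⊥} v∈
  ... | _ , i∈⊥ , _ with ∉⊥ i∈⊥
  ... | ()

esd : ℕ → SimplicialComplex → SimplicialComplex
esd r Γ = record
  { ground = length L
  ; Face   = λ E → Face Γ (supportUnion L E)
                 × (∀ i j → i ∈ E → j ∈ E → Close (List.lookup L i) (List.lookup L j))
  ; face?  = λ E → face? Γ (supportUnion L E)
                 ×-dec (all? λ i → all? λ j → (i ∈? E) →-dec ((j ∈? E) →-dec
                   ((ι (List.lookup L i) -01?- ι (List.lookup L j))
                     ⊎-dec (ι (List.lookup L j) -01?- ι (List.lookup L i)))))
  ; ⊥-face = closed Γ (supportUnion-⊥ L) (⊥-face Γ)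
           , λ i j i∈⊥ _ → ⊥-elim (∉⊥ i∈⊥)
  ; closed = λ S⊆T (face , close) →
               closed Γ (supportUnion-mono L S⊆T) face
             , λ i j i∈S j∈S → close i j (S⊆T i∈S) (S⊆T j∈S)
  }
  where
  L = esdVertices r Γ

coloredSd : ℕ → SimplicialComplex → SimplicialComplex
coloredSd r Δ = esd r (sd Δ)

Matrix : ℕ → ℕ → Set
Matrix m n = Fin m → Fin n → ℚ

_*ᵥ_ : Matrix m n → Vector ℚ n → Vector ℚ m
(M *ᵥ v) i = ∑ λ j → M i j ℚ.* v j

-- Since the subdivision of Δ again has dimension d - 1, its h-vector is
-- also formed with respect to d.  Such a matrix H is unique, since the
-- h-vectors of the complexes of dimension d - 1 span ℚᵈ⁺¹.

IsTransformationMatrix : (d r : ℕ) → Matrix (suc d) (suc d) → Set₁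
IsTransformationMatrix d r H =
  ∀ Δ → HasDim+1 Δ d → ∀ i → hVector d (coloredSd r Δ) i ≡ (H *ᵥ hVector d Δ) i

record TP₂ (M : Matrix m n) : Set where
  field
    entries : ∀ i j → 0ℚ ℚ.≤ M i j
    minors  : ∀ {i i′ j j′} → i Fin.< i′ → j Fin.< j′ →
              0ℚ ℚ.≤ M i j ℚ.* M i′ j′ ℚ.- M i j′ ℚ.* M i′ j

{-# OPTIONS --safe #-}

-- For any complex Γ, the h-vector taken with respect to d is given by
-- (1 - x)ᵈ ∑ₙ M(Γ, n) xⁿ, where M(Γ, n) is the number of multisets of n
-- vertices supported on a face.  A chain of vectors with pairwise differences
-- in {0,1}ᵍ is determined by its length and its sum, being the sequence of
-- roundings of its mean; hence M(esd_r Γ, n) = M(Γ, r n), and M(sd Δ, m) is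
-- W(m) - W(m - 1) where W(m) counts the v ∈ {0,…,m}ᵍ supported on a face of Δ.
-- Applied to complexes with h-polynomials 1 + x + ⋯ + xʲ, this shows that the
-- j-th column of H is the polynomial (1 - x)ᵈ E_r [(1 - x) ∑ₛ F_j(s) xˢ] with
-- F_j(s) = sʲ (s + 1)ᵈ⁻ʲ.
--
-- For total positivity, arrange the power series xᵗ F_{d,j} (0 ≤ j ≤ d) in a
-- single infinite list, ordered by t and then by j, and apply
-- f ↦ (1 - x)ᵈ⁺¹ E_r f to each of them.  Since F_{d+1,j} - F_{d+1,j+1} = F_{d,j}
-- and F_{d+1,d+1} = x F_{d+1,0}, telescoping shows that every column of the
-- list for d + 1 is the sum of r (d + 1) consecutive columns of the list for d,
-- the windows moving to the right; the columns of H are such sums too.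
-- Window sums of this kind preserve the non-negativity of 2 × 2 minors.

module Submission where

open import Defs
open import Data.Nat.Base
open import Data.Bool.Base as Bool using (Bool; true; false; if_then_else_; f<t)
open import Data.Empty using (⊥-elim)
open import Data.Fin.Base as Fin using (Fin; toℕ)
open import Data.Fin.Properties using (any?; toℕ≤pred[n]; toℕ<n)
open import Data.Fin.Subset as Subset using (Subset; inside; outside; ∣_∣)
open import Data.Fin.Subset.Properties using (drop-∷-⊆; nonempty?; ∣⊤∣≡n; ∣p∣≤n)
import Data.Integer.Base as ℤ
import Data.Integer.Properties as ℤ
open import Data.List.Base as List using (List; []; _∷_; _++_; length; filter; map;
  replicate; applyUpTo; upTo; cartesianProductWith)
open import Data.List.Membership.Propositional using (_∈_)
open import Data.List.Membership.Propositional.Properties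
open import Data.List.Membership.Propositional.Properties.WithK using (unique∧set⇒bag)
open import Data.List.Properties using (length-++; length-map; length-replicate; length-upTo;
  length-applyUpTo; filter-++; map-++; map-∘; map-cong; map-cong-local;
  map-injective; map-applyUpTo; ∷-injectiveʳ; ++-identityʳ)
open import Data.List.Relation.Binary.BagAndSetEquality using (∼bag⇒↭)
open import Data.List.Relation.Binary.Permutation.Propositional.Properties using (↭-length)
open import Data.List.Relation.Unary.All as All using (All; []; _∷_)
import Data.List.Relation.Unary.All.Properties as All
open import Data.List.Relation.Unary.AllPairs as AllPairs using (AllPairs; []; _∷_)
import Data.List.Relation.Unary.AllPairs.Properties as AllPairs
open import Data.List.Relation.Unary.Any using (here; there)
open import Data.List.Relation.Unary.Unique.Propositional using (Unique)
open import Data.Nat.DivMod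
open import Data.Nat.Divisibility using (∣-refl)
open import Data.Nat.ListAction using (sum)
open import Data.Nat.ListAction.Properties using (sum-++)
open import Data.Nat.Properties
open import Data.Nat.Tactic.RingSolver using (solve-∀)
open import Data.Product.Base using (∃; _×_; _,_; proj₁; proj₂)
open import Data.Rational.Base as ℚ using (ℚ; 0ℚ; 1ℚ; toℚᵘ)
import Data.Rational.Properties as ℚ
open import Data.Rational.Solver using (module +-*-Solver)
open import Data.Rational.Unnormalised.Base as ℚᵘ using (mkℚᵘ; *≡*; *≤*)
import Data.Rational.Unnormalised.Properties as ℚᵘ
open import Data.Sum.Base as Sum using (_⊎_; inj₁; inj₂)
open import Data.Unit.Base using (tt)
open import Data.Vec.Base as Vec using (Vec; []; _∷_; head; tail; here; there; zipWith)
open import Data.Vec.Functional using (Vector)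
import Data.Vec.Properties as Vec
open import Data.Vec.Relation.Binary.Pointwise.Inductive as Pointwise using (Pointwise; []; _∷_)
open import Function.Base using (_∘_; _on_)
open import Function.Bundles using (mk⇔)
open import Function.Definitions using (Injective)
open import Level using (0ℓ)
open import Relation.Binary.Core using (Rel)
open import Relation.Binary.Definitions using (Reflexive)
open import Relation.Binary.PropositionalEquality
open import Relation.Nullary using (¬_)
open import Relation.Nullary.Decidable using (does; _×-dec_; yes; no; ¬?; map′)
open import Relation.Unary using (Decidable)
open import Algebra.Properties.CommutativeSemigroup +-commutativeSemigroup using (interchange; x∙yz≈y∙xz)
open import Algebra.Properties.Group ℚ.+-0-group using (∙-cancelˡ)

-- The windows have length `r (d + 1)` and in general run past the `d + 1` series with `t = 0`; this
-- is why all multiples by powers of x are put into one infinite list. The length comes from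
-- `(1 - x) E_r = E_r (1 - xʳ)`: subtracting the multiple by xʳ amounts to moving `r` whole periods
-- to the right. The list for `d + 1` has period `d + 2`, one more than the period in which it
-- telescopes, because the last series of a period is also the first of the next one. Hence
-- different columns can have the same window, and positivity has to be formulated for weakly
-- ordered columns. All coefficients are natural numbers by construction, so non-negativity of the
-- entries is built in; rational numbers only enter to connect them with h-vectors. The matrix is
-- given only by its action on h-vectors of actual complexes. The polynomials 1 + x + ⋯ + xʲ form a
-- triangular basis, so what becomes visible is the sum of the first `j + 1` columns, and a column
-- is the difference of two such sums.

private
  variable
    A B : Set
    g : ℕ

-- Window sums and 2 × 2 minors

window : (ℕ → ℕ) → ℕ → ℕ → ℕ
window f a zero    = 0
window f a (suc l) = f a + window f (suc a) l

window-++ : ∀ f a p q → window f a (p + q) ≡ window f a p + window f (p + a) q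
window-++ f a zero    q = refl
window-++ f a (suc p) q = trans
  (cong (f a +_) (trans (window-++ f (suc a) p q)
    (cong (λ b → window f (suc a) p + window f b q) (+-suc p a))))
  (sym (+-assoc (f a) _ _))

window-telescope : ∀ {f g : ℕ → ℕ} → (∀ a → f a ≡ f (suc a) + g a) →
                   ∀ a l → f a ≡ f (l + a) + window g a l
window-telescope {f} step a zero    = sym (+-identityʳ (f a))
window-telescope {f} {g} step a (suc l) = begin
  f a                                          ≡⟨ step a ⟩
  f (suc a) + g a                              ≡⟨ cong (_+ g a) (window-telescope step (suc a) l) ⟩
  f (l + suc a) + window g (suc a) l + g a     ≡⟨ cong (λ b → f b + window g (suc a) l + g a) (+-suc l a) ⟩
  f (suc l + a) + window g (suc a) l + g a     ≡⟨ +-assoc (f (suc l + a)) _ _ ⟩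
  f (suc l + a) + (window g (suc a) l + g a)   ≡⟨ cong (f (suc l + a) +_) (+-comm _ (g a)) ⟩
  f (suc l + a) + window g a (suc l)           ∎
  where open ≡-Reasoning

-- The 2 × 2 minors of the two rows `u` and `v`. Cross-multiplication admits zero entries, and equal
-- columns give equality, so `a ≤ b` costs nothing compared with `a < b`.
RatioMonotone : (ℕ → ℕ) → (ℕ → ℕ) → Set
RatioMonotone u v = ∀ {a b} → a ≤ b → u b * v a ≤ u a * v b

module _ {u v : ℕ → ℕ} (mono : RatioMonotone u v) where

  private
    point-block : ∀ a b q → a ≤ b → window u b q * v a ≤ u a * window v b q
    point-block a b zero    a≤b = z≤n
    point-block a b (suc q) a≤b = begin
      (u b + window u (suc b) q) * v a       ≡⟨ *-distribʳ-+ (v a) (u b) _ ⟩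
      u b * v a + window u (suc b) q * v a   ≤⟨ +-mono-≤ (mono a≤b) (point-block a (suc b) q (m≤n⇒m≤1+n a≤b)) ⟩
      u a * v b + u a * window v (suc b) q   ≡⟨ *-distribˡ-+ (u a) (v b) _ ⟨
      u a * (v b + window v (suc b) q)       ∎
      where open ≤-Reasoning

    -- For separated blocks all pairs in the expanded product are ordered the same way, so the
    -- inequality holds term by term.
    block-block : ∀ a p b q → p + a ≤ b →
                  window u b q * window v a p ≤ window u a p * window v b q
    block-block a zero    b q _     = ≤-reflexive (*-zeroʳ (window u b q))
    block-block a (suc p) b q 1+p+a≤b = begin
      window u b q * (v a + window v (suc a) p)
        ≡⟨ *-distribˡ-+ (window u b q) (v a) _ ⟩
      window u b q * v a + window u b q * window v (suc a) p
        ≤⟨ +-mono-≤ (point-block a b q (≤-trans (m≤n+m a (suc p)) 1+p+a≤b))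
                    (block-block (suc a) p b q (subst (_≤ b) (sym (+-suc p a)) 1+p+a≤b)) ⟩
      u a * window v b q + window u (suc a) p * window v b q
        ≡⟨ *-distribʳ-+ (window v b q) (u a) _ ⟨
      (u a + window u (suc a) p) * window v b q ∎
      where open ≤-Reasoning

  -- Overlapping windows A ∪ B and B ∪ C with A < B < C: the terms B × B cancel.
  window-ratioMonotone : ∀ l → RatioMonotone (λ a → window u a l) (λ a → window v a l)
  window-ratioMonotone l {a} {b} a≤b with ≤-total l (b ∸ a)
  ... | inj₁ l≤b∸a = block-block a l b l
          (subst (l + a ≤_) (m∸n+n≡m a≤b) (+-monoˡ-≤ a l≤b∸a))
  ... | inj₂ k≤l = begin
    window u b l * window v a l            ≡⟨ cong₂ _*_ (second u) (first v) ⟩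
    (uB + uC) * (vA + vB)                  ≡⟨ expand uB uC vA vB ⟩
    uB * vA + uC * vA + uC * vB + uB * vB  ≤⟨ +-monoˡ-≤ (uB * vB) (+-mono-≤ (+-mono-≤
                                                (block-block a k (k + a) o ≤-refl)
                                                (block-block a k (o + (k + a)) k (m≤n+m (k + a) o)))
                                                (block-block (k + a) o (o + (k + a)) k ≤-refl)) ⟩
    uA * vB + uA * vC + uB * vC + uB * vB  ≡⟨ contract uA uB vB vC ⟩
    (uA + uB) * (vB + vC)                  ≡⟨ cong₂ _*_ (first u) (second v) ⟨
    window u a l * window v b l            ∎
    where
    open ≤-Reasoning
    k o : ℕ
    k = b ∸ a
    o = l ∸ k
    uA uB uC vA vB vC : ℕ
    uA = window u a k
    uB = window u (k + a) o
    uC = window u (o + (k + a)) k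
    vA = window v a k
    vB = window v (k + a) o
    vC = window v (o + (k + a)) k
    first : ∀ f → window f a l ≡ window f a k + window f (k + a) o
    first f = trans (cong (window f a) (sym (m+[n∸m]≡n k≤l))) (window-++ f a k o)
    second : ∀ f → window f b l ≡ window f (k + a) o + window f (o + (k + a)) k
    second f = trans (cong₂ (window f) (sym (m∸n+n≡m a≤b)) (sym (m∸n+n≡m k≤l)))
                     (window-++ f (k + a) o k)
    expand : ∀ uB uC vA vB → (uB + uC) * (vA + vB) ≡ uB * vA + uC * vA + uC * vB + uB * vB
    expand = solve-∀
    contract : ∀ uA uB vB vC → uA * vB + uA * vC + uB * vC + uB * vB ≡ (uA + uB) * (vB + vC)
    contract = solve-∀

-- The position in the list of period m that corresponds to the position τ in
-- the list of period 1 + m obtained by repeating the first entry of each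
-- period at the end of the preceding one.
collapse : ℕ → ℕ → ℕ
collapse m τ = τ % suc m + τ / suc m * m

module _ {j n : ℕ} .{{_ : NonZero n}} (t : ℕ) (j<n : j < n) where

  [j+t*n]%n≡j : (j + t * n) % n ≡ j
  [j+t*n]%n≡j = trans ([m+kn]%n≡m%n j t n) (m<n⇒m%n≡m j<n)

  [j+t*n]/n≡t : (j + t * n) / n ≡ t
  [j+t*n]/n≡t = begin
    (j + t * n) / n       ≡⟨ +-distrib-/ j (t * n) (subst (_< n) (sym rem) j<n) ⟩
    j / n + t * n / n     ≡⟨ cong₂ _+_ (m<n⇒m/n≡0 j<n) (m*n/n≡m t n) ⟩
    t                     ∎
    where
    open ≡-Reasoning
    rem : j % n + t * n % n ≡ j
    rem = trans (cong₂ _+_ (m<n⇒m%n≡m j<n) (m*n%n≡0 t n)) (+-identityʳ j)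

collapse-mono : ∀ m {a b} → a ≤ b → collapse m a ≤ collapse m b
collapse-mono m {a} {b} a≤b with m≤n⇒m<n∨m≡n (/-monoˡ-≤ (suc m) a≤b)
... | inj₁ q<q′ = begin
  a % suc m + a / suc m * m   ≤⟨ +-monoˡ-≤ _ (s≤s⁻¹ (m%n<n a (suc m))) ⟩
  -- The largest remainder `m`, the repeated entry, lands where the next period starts, so a larger
  -- quotient never moves to the left.
  m + a / suc m * m           ≤⟨ *-monoˡ-≤ m q<q′ ⟩
  b / suc m * m               ≤⟨ m≤n+m _ (b % suc m) ⟩
  b % suc m + b / suc m * m   ∎
  where open ≤-Reasoning
... | inj₂ q≡q′ = +-mono-≤ rem≤ (≤-reflexive (cong (_* m) q≡q′))
  where
  rem≤ : a % suc m ≤ b % suc m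
  rem≤ = +-cancelʳ-≤ (a / suc m * suc m) _ _ (subst₂ _≤_ (m≡m%n+[m/n]*n a (suc m))
    (trans (m≡m%n+[m/n]*n b (suc m)) (cong (λ q → b % suc m + q * suc m) (sym q≡q′))) a≤b)

-- The periodic lists of power series and their telescoping

shift : ℕ → (ℕ → ℕ) → ℕ → ℕ
shift zero    f s       = f s
shift (suc t) f zero    = 0
shift (suc t) f (suc s) = shift t f s

shift-cong : ∀ t {f g} → (∀ s → f s ≡ g s) → ∀ s → shift t f s ≡ shift t g s
shift-cong zero    eq s       = eq s
shift-cong (suc t) eq zero    = refl
shift-cong (suc t) eq (suc s) = shift-cong t eq s

shift-shift : ∀ l t f s → shift (l + t) f s ≡ shift l (shift t f) s
shift-shift zero    t f s       = refl
shift-shift (suc l) t f zero    = refl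
shift-shift (suc l) t f (suc s) = shift-shift l t f s

shift-+ : ∀ t f g s → shift t (λ s → f s + g s) s ≡ shift t f s + shift t g s
shift-+ zero    f g s       = refl
shift-+ (suc t) f g zero    = refl
shift-+ (suc t) f g (suc s) = shift-+ t f g s

shift-late : ∀ t f s → shift t f (t + s) ≡ f s
shift-late zero    f s = refl
shift-late (suc t) f s = shift-late t f s

-- (1 - x) E_r = E_r (1 - xʳ)
shift-section : ∀ r .{{_ : NonZero r}} f n → shift r f (r * n) ≡ shift 1 (λ n → f (r * n)) n
shift-section (suc r) f zero    rewrite *-zeroʳ r = refl
shift-section (suc r) f (suc n) =
  trans (cong (shift (suc r) f) (*-suc (suc r) n)) (shift-late (suc r) f (suc r * n))

-- The power series of F d j is P_{d,j}(x) / (1 - x)ᵈ⁺¹.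
F : ℕ → ℕ → ℕ → ℕ
F d j s = s ^ j * suc s ^ (d ∸ j)

-- One factor `s + 1` is split into `s` and 1; `j ≤ d` guarantees that such a factor is there.
F-pascal : ∀ {d j} → j ≤ d → ∀ s → F (suc d) j s ≡ F (suc d) (suc j) s + F d j s
F-pascal {d} {j} j≤d s = begin
  s ^ j * suc s ^ (suc d ∸ j)              ≡⟨ cong (λ e → s ^ j * suc s ^ e) (+-∸-assoc 1 j≤d) ⟩
  s ^ j * (suc s * suc s ^ (d ∸ j))        ≡⟨ rearrange (s ^ j) s (suc s ^ (d ∸ j)) ⟩
  s * s ^ j * suc s ^ (d ∸ j) + s ^ j * suc s ^ (d ∸ j)  ∎
  where
  open ≡-Reasoning
  rearrange : ∀ x s y → x * (suc s * y) ≡ s * x * y + x * y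
  rearrange = solve-∀

F-last : ∀ d s → F (suc d) (suc d) s ≡ shift 1 (F (suc d) 0) s
F-last d zero    = refl
F-last d (suc s) = trans (trans (cong (λ e → suc s ^ suc d * suc (suc s) ^ e) (n∸n≡0 (suc d)))
  (*-identityʳ (suc s ^ suc d))) (sym (*-identityˡ (suc s ^ suc d)))

-- xᵗ F d j sits at position j + t (d + 1) of the list Φ d.  Since
-- F (d + 1) (d + 1) = x F (d + 1) 0, the list Ψ d of the xᵗ F (d + 1) j can be
-- given the period d + 1 as well.
Φ Ψ : ℕ → ℕ → ℕ → ℕ
Φ d τ = shift (τ / suc d) (F d (τ % suc d))
Ψ d τ = shift (τ / suc d) (F (suc d) (τ % suc d))

Φ-at : ∀ {d j} t → j ≤ d → ∀ s → Φ d (j + t * suc d) s ≡ shift t (F d j) s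
Φ-at {d} t j≤d s = cong₂ (λ q i → shift q (F d i) s) ([j+t*n]/n≡t t (s≤s j≤d)) ([j+t*n]%n≡j t (s≤s j≤d))

Ψ-at : ∀ {d j} t → j ≤ suc d → ∀ s → Ψ d (j + t * suc d) s ≡ shift t (F (suc d) j) s
Ψ-at {d} {j} t j≤1+d s with m≤n⇒m<n∨m≡n j≤1+d
... | inj₁ j<1+d = cong₂ (λ q i → shift q (F (suc d) i) s) ([j+t*n]/n≡t t j<1+d) ([j+t*n]%n≡j t j<1+d)
-- The index `d + 1` overflows into the next period, whose first series is the same by `F-last`.
... | inj₂ refl  = begin
  Ψ d (0 + suc t * suc d) s          ≡⟨ cong₂ (λ q i → shift q (F (suc d) i) s)
                                          ([j+t*n]/n≡t {n = suc d} (suc t) z<s) ([j+t*n]%n≡j {n = suc d} (suc t) z<s) ⟩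
  shift (suc t) (F (suc d) 0) s      ≡⟨ cong (λ q → shift q (F (suc d) 0) s) (+-comm t 1) ⟨
  shift (t + 1) (F (suc d) 0) s      ≡⟨ shift-shift t 1 (F (suc d) 0) s ⟩
  shift t (shift 1 (F (suc d) 0)) s  ≡⟨ shift-cong t (F-last d) s ⟨
  shift t (F (suc d) (suc d)) s      ∎
  where open ≡-Reasoning

-- The purpose of the shorter period of `Ψ`: neighbouring positions always differ by one use of
-- `F-pascal`, with no exceptional step at the end of a period.
Ψ-step : ∀ d τ s → Ψ d τ s ≡ Ψ d (suc τ) s + Φ d τ s
Ψ-step d τ s = begin
  Ψ d τ s                                      ≡⟨ cong (λ τ → Ψ d τ s) τ≡ ⟩
  Ψ d (j + t * suc d) s                        ≡⟨ Ψ-at t (m≤n⇒m≤1+n j≤d) s ⟩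
  shift t (F (suc d) j) s                      ≡⟨ shift-cong t (F-pascal j≤d) s ⟩
  shift t (λ s → F (suc d) (suc j) s + F d j s) s  ≡⟨ shift-+ t (F (suc d) (suc j)) (F d j) s ⟩
  shift t (F (suc d) (suc j)) s + Φ d τ s      ≡⟨ cong (_+ Φ d τ s) (Ψ-at t (s≤s j≤d) s) ⟨
  Ψ d (suc j + t * suc d) s + Φ d τ s          ≡⟨ cong (λ τ′ → Ψ d (suc τ′) s + Φ d τ s) τ≡ ⟨
  Ψ d (suc τ) s + Φ d τ s                      ∎
  where
  open ≡-Reasoning
  j t : ℕ
  j = τ % suc d
  t = τ / suc d
  τ≡ : τ ≡ j + t * suc d
  τ≡ = m≡m%n+[m/n]*n τ (suc d)
  j≤d : j ≤ d
  j≤d = s≤s⁻¹ (m%n<n τ (suc d))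

Ψ-period : ∀ d l τ s → Ψ d (l * suc d + τ) s ≡ shift l (Ψ d τ) s
Ψ-period d l τ s = begin
  Ψ d (l * suc d + τ) s              ≡⟨ cong (λ τ → Ψ d τ s) τ≡ ⟩
  Ψ d (j + (l + t) * suc d) s        ≡⟨ Ψ-at (l + t) (<⇒≤ (m%n<n τ (suc d))) s ⟩
  shift (l + t) (F (suc d) j) s      ≡⟨ shift-shift l t (F (suc d) j) s ⟩
  shift l (Ψ d τ) s                  ∎
  where
  open ≡-Reasoning
  j t : ℕ
  j = τ % suc d
  t = τ / suc d
  rearrange : ∀ l j t n → l * n + (j + t * n) ≡ j + (l + t) * n
  rearrange = solve-∀
  τ≡ : l * suc d + τ ≡ j + (l + t) * suc d
  τ≡ = trans (cong (l * suc d +_) (m≡m%n+[m/n]*n τ (suc d))) (rearrange l j t (suc d))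

-- After `l` whole periods the telescoping remainder is xˡ times the initial series, so `1 - xˡ`
-- times a series of `Ψ` is a window of `Φ`. The case `l = r` drives the recursion on `d`, the case
-- `l = 1` yields the columns of the matrix.
Ψ-window : ∀ d l τ s → Ψ d τ s ≡ shift l (Ψ d τ) s + window (λ τ → Φ d τ s) τ (l * suc d)
Ψ-window d l τ s = trans (window-telescope (λ τ → Ψ-step d τ s) τ (l * suc d))
  (cong (_+ window (λ τ → Φ d τ s) τ (l * suc d)) (Ψ-period d l τ s))

Φ-collapse : ∀ d τ s → Φ (suc d) τ s ≡ Ψ d (collapse (suc d) τ) s
Φ-collapse d τ s = sym (Ψ-at (τ / suc (suc d)) (s≤s⁻¹ (m%n<n τ (suc (suc d)))) s)

indicator : ℕ → ℕ → ℕ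
indicator s τ = if s ≡ᵇ τ then 1 else 0

indicator-≢ : ∀ s τ → s ≢ τ → indicator s τ ≡ 0
indicator-≢ s τ s≢τ with s ≡ᵇ τ | ≡ᵇ⇒≡ s τ
... | false | _  = refl
... | true  | eq = ⊥-elim (s≢τ (eq _))

-- The bottom list has one series per period, namely xᵗ / (1 - x).
Φ₀ : ∀ τ s → Φ 0 τ s ≡ shift τ (λ _ → 1) s
Φ₀ τ s = trans (cong (λ τ → Φ 0 τ s) (sym (*-identityʳ τ)))
  (trans (Φ-at {0} τ z≤n s) (shift-cong τ (λ _ → refl) s))

Φ₀-step : ∀ τ s → Φ 0 τ s ≡ Φ 0 (suc τ) s + indicator s τ
Φ₀-step τ s = trans (Φ₀ τ s) (trans (step τ s) (cong (_+ indicator s τ) (sym (Φ₀ (suc τ) s))))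
  where
  step : ∀ τ s → shift τ (λ _ → 1) s ≡ shift (suc τ) (λ _ → 1) s + indicator s τ
  step zero    zero    = refl
  step zero    (suc s) = refl
  step (suc τ) zero    = refl
  step (suc τ) (suc s) = step τ s

Φ₀-window : ∀ l τ s → Φ 0 τ s ≡ shift l (Φ 0 τ) s + window (indicator s) τ l
Φ₀-window l τ s = trans (window-telescope (λ τ → Φ₀-step τ s) τ l) (cong (_+ window (indicator s) τ l)
  (trans (Φ₀ (l + τ) s) (trans (shift-shift l τ _ s) (shift-cong l (λ s → sym (Φ₀ τ s)) s))))

-- The coefficient of xⁿ in (1 - x)ᵈ⁺¹ E_r (Φ d τ); see diff-Φ.
C : (r d : ℕ) → ℕ → ℕ → ℕ
C r zero    τ n = window (indicator (r * n)) τ r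
C r (suc d) τ n = window (λ τ → C r d τ n) (collapse (suc d) τ) (r * suc d)

-- At `d = 0` the two rows are windows of unit vectors at `r * n < r * n′`; a positive left-hand
-- side would need `b = r * n` and `a = r * n′`, against `a ≤ b`. Each further `d` is one window sum
-- with weakly increasing left ends.
C-ratioMonotone : ∀ r .{{_ : NonZero r}} d {n n′} → n < n′ →
                  RatioMonotone (λ τ → C r d τ n) (λ τ → C r d τ n′)
C-ratioMonotone r zero    {n} {n′} n<n′ = window-ratioMonotone disjoint r
  where
  disjoint : RatioMonotone (indicator (r * n)) (indicator (r * n′))
  disjoint {a} {b} a≤b with r * n ≟ b | r * n′ ≟ a
  ... | no rn≢b | _        rewrite indicator-≢ (r * n) b rn≢b = z≤n
  ... | yes _   | no rn′≢a rewrite indicator-≢ (r * n′) a rn′≢a =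
    ≤-trans (≤-reflexive (*-zeroʳ (indicator (r * n) b))) z≤n
  ... | yes rn≡b | yes rn′≡a =
    ⊥-elim (<⇒≱ (*-monoʳ-< r n<n′) (subst₂ _≤_ (sym rn′≡a) (sym rn≡b) a≤b))
C-ratioMonotone r (suc d) n<n′ a≤b =
  window-ratioMonotone (C-ratioMonotone r d n<n′) (r * suc d) (collapse-mono (suc d) a≤b)

window-cong : ∀ {f g} → (∀ a → f a ≡ g a) → ∀ a l → window f a l ≡ window g a l
window-cong eq a zero    = refl
window-cong eq a (suc l) = cong₂ _+_ (eq a) (window-cong eq (suc a) l)

-- Power series with rational coefficients

toℚᵘ-fromℕ : ∀ k → toℚᵘ (fromℕ k) ℚᵘ.≃ mkℚᵘ (ℤ.+ k) 0
toℚᵘ-fromℕ k = ℚ.toℚᵘ-fromℚᵘ (mkℚᵘ (ℤ.+ k) 0)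

fromℕ-+ : ∀ m n → fromℕ (m + n) ≡ fromℕ m ℚ.+ fromℕ n
fromℕ-+ m n = ℚ.toℚᵘ-injective (begin
  toℚᵘ (fromℕ (m + n))                     ≈⟨ toℚᵘ-fromℕ (m + n) ⟩
  mkℚᵘ (ℤ.+ (m + n)) 0                     ≈⟨ *≡* (cong (ℤ._* ℤ.1ℤ) (cong₂ ℤ._+_
                                                (sym (ℤ.*-identityʳ (ℤ.+ m))) (sym (ℤ.*-identityʳ (ℤ.+ n))))) ⟩
  mkℚᵘ (ℤ.+ m) 0 ℚᵘ.+ mkℚᵘ (ℤ.+ n) 0       ≈⟨ ℚᵘ.+-cong (toℚᵘ-fromℕ m) (toℚᵘ-fromℕ n) ⟨
  toℚᵘ (fromℕ m) ℚᵘ.+ toℚᵘ (fromℕ n)       ≈⟨ ℚ.toℚᵘ-homo-+ (fromℕ m) (fromℕ n) ⟨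
  toℚᵘ (fromℕ m ℚ.+ fromℕ n)               ∎)
  where open ℚᵘ.≃-Reasoning

fromℕ-* : ∀ m n → fromℕ (m * n) ≡ fromℕ m ℚ.* fromℕ n
fromℕ-* m n = ℚ.toℚᵘ-injective (begin
  toℚᵘ (fromℕ (m * n))                     ≈⟨ toℚᵘ-fromℕ (m * n) ⟩
  mkℚᵘ (ℤ.+ (m * n)) 0                     ≈⟨ *≡* (cong (ℤ._* ℤ.1ℤ) (ℤ.pos-* m n)) ⟩
  mkℚᵘ (ℤ.+ m) 0 ℚᵘ.* mkℚᵘ (ℤ.+ n) 0       ≈⟨ ℚᵘ.*-cong (toℚᵘ-fromℕ m) (toℚᵘ-fromℕ n) ⟨
  toℚᵘ (fromℕ m) ℚᵘ.* toℚᵘ (fromℕ n)       ≈⟨ ℚ.toℚᵘ-homo-* (fromℕ m) (fromℕ n) ⟨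
  toℚᵘ (fromℕ m ℚ.* fromℕ n)               ∎)
  where open ℚᵘ.≃-Reasoning

fromℕ-mono-≤ : ∀ {m n} → m ≤ n → fromℕ m ℚ.≤ fromℕ n
fromℕ-mono-≤ {m} {n} m≤n = ℚ.toℚᵘ-cancel-≤ (begin
  toℚᵘ (fromℕ m)    ≃⟨ toℚᵘ-fromℕ m ⟩
  mkℚᵘ (ℤ.+ m) 0    ≤⟨ *≤* (ℤ.*-monoʳ-≤-nonNeg ℤ.1ℤ (ℤ.+≤+ m≤n)) ⟩
  mkℚᵘ (ℤ.+ n) 0    ≃⟨ toℚᵘ-fromℕ n ⟨
  toℚᵘ (fromℕ n)    ∎)
  where open ℚᵘ.≤-Reasoning

∑-cong : ∀ {n} {v w : Vector ℚ n} → (∀ i → v i ≡ w i) → ∑ v ≡ ∑ w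
∑-cong {zero}  eq = refl
∑-cong {suc n} eq = cong₂ ℚ._+_ (eq Fin.zero) (∑-cong (eq ∘ Fin.suc))

∑-zero : ∀ {n} {v : Vector ℚ n} → (∀ i → v i ≡ 0ℚ) → ∑ v ≡ 0ℚ
∑-zero {zero}  eq = refl
∑-zero {suc n} eq = cong₂ ℚ._+_ (eq Fin.zero) (∑-zero (eq ∘ Fin.suc))

∑-+ : ∀ {n} (v w : Vector ℚ n) → ∑ (λ i → v i ℚ.+ w i) ≡ ∑ v ℚ.+ ∑ w
∑-+ {zero}  v w = refl
∑-+ {suc n} v w = trans (cong (v Fin.zero ℚ.+ w Fin.zero ℚ.+_) (∑-+ (v ∘ Fin.suc) (w ∘ Fin.suc)))
  (solve 4 (λ a b c d → a :+ b :+ (c :+ d) := a :+ c :+ (b :+ d)) refl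
    (v Fin.zero) (w Fin.zero) (∑ (v ∘ Fin.suc)) (∑ (w ∘ Fin.suc)))
  where open +-*-Solver

∑-*-minus : ∀ {n} (a v w : Vector ℚ n) →
            ∑ (λ i → a i ℚ.* v i) ℚ.- ∑ (λ i → a i ℚ.* w i) ≡ ∑ (λ i → a i ℚ.* (v i ℚ.- w i))
∑-*-minus {zero}  a v w = refl
∑-*-minus {suc n} a v w = trans
  (solve 5 (λ a v w s t → a :* v :+ s :- (a :* w :+ t) := a :* (v :- w) :+ (s :- t)) refl
    (a Fin.zero) (v Fin.zero) (w Fin.zero)
    (∑ (λ i → a (Fin.suc i) ℚ.* v (Fin.suc i))) (∑ (λ i → a (Fin.suc i) ℚ.* w (Fin.suc i))))
  (cong (a Fin.zero ℚ.* (v Fin.zero ℚ.- w Fin.zero) ℚ.+_) (∑-*-minus (a ∘ Fin.suc) (v ∘ Fin.suc) (w ∘ Fin.suc)))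
  where open +-*-Solver

diff : ℕ → Poly → Poly
diff zero    p = p
diff (suc d) p = diff d ([1-x]· p)

[1-x]·-cong : ∀ {p q k} → (∀ {i} → i ≤ k → p i ≡ q i) → ([1-x]· p) k ≡ ([1-x]· q) k
[1-x]·-cong {k = zero}  eq = cong (ℚ._- 0ℚ) (eq ≤-refl)
[1-x]·-cong {k = suc k} eq = cong₂ ℚ._-_ (eq ≤-refl) (eq (n≤1+n k))

diff-cong-≤ : ∀ d {p q k} → (∀ {i} → i ≤ k → p i ≡ q i) → diff d p k ≡ diff d q k
diff-cong-≤ zero    eq = eq ≤-refl
diff-cong-≤ (suc d) eq = diff-cong-≤ d (λ i≤k → [1-x]·-cong (λ h≤i → eq (≤-trans h≤i i≤k)))

diff-cong : ∀ d {p q} → p ≗ q → diff d p ≗ diff d q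
diff-cong d eq k = diff-cong-≤ d (λ {i} _ → eq i)

x·-cong : ∀ {p q} → p ≗ q → x· p ≗ x· q
x·-cong eq zero    = refl
x·-cong eq (suc k) = eq k

diff-[1-x] : ∀ d p → diff d ([1-x]· p) ≗ [1-x]· (diff d p)
diff-[1-x] zero    p k = refl
diff-[1-x] (suc d) p k = diff-[1-x] d ([1-x]· p) k

diff-x : ∀ d p → diff d (x· p) ≗ x· (diff d p)
diff-x zero    p k = refl
diff-x (suc d) p k = trans (diff-cong d commute k) (diff-x d ([1-x]· p) k)
  where
  commute : [1-x]· (x· p) ≗ x· ([1-x]· p)
  commute zero          = refl
  commute (suc zero)    = refl
  commute (suc (suc k)) = refl

diff-∑ : ∀ d {n} (a : Vector ℚ n) (p : Fin n → Poly) k →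
         diff d (λ k → ∑ (λ i → a i ℚ.* p i k)) k ≡ ∑ (λ i → a i ℚ.* diff d (p i) k)
diff-∑ zero    a p k = refl
diff-∑ (suc d) a p k = trans (diff-cong d linear k) (diff-∑ d a (λ i → [1-x]· (p i)) k)
  where
  linear : [1-x]· (λ k → ∑ (λ i → a i ℚ.* p i k)) ≗ (λ k → ∑ (λ i → a i ℚ.* ([1-x]· (p i)) k))
  linear zero    = trans (cong (λ z → ∑ (λ i → a i ℚ.* p i 0) ℚ.- z)
    (sym (∑-zero (λ i → ℚ.*-zeroʳ (a i))))) (∑-*-minus a (λ i → p i 0) (λ _ → 0ℚ))
  linear (suc k) = ∑-*-minus a (λ i → p i (suc k)) (λ i → p i k)

diff-+ : ∀ d p q → diff d (λ k → p k ℚ.+ q k) ≗ (λ k → diff d p k ℚ.+ diff d q k)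
diff-+ zero    p q k = refl
diff-+ (suc d) p q k = trans (diff-cong d linear k) (diff-+ d ([1-x]· p) ([1-x]· q) k)
  where
  open +-*-Solver
  linear : [1-x]· (λ k → p k ℚ.+ q k) ≗ (λ k → ([1-x]· p) k ℚ.+ ([1-x]· q) k)
  linear zero    = solve 2 (λ a b → a :+ b :- con 0ℚ := a :- con 0ℚ :+ (b :- con 0ℚ)) refl (p 0) (q 0)
  linear (suc k) = solve 4 (λ a b c d → a :+ b :- (c :+ d) := a :- c :+ (b :- d)) refl
    (p (suc k)) (q (suc k)) (p k) (q k)

diff-zero : ∀ d k → diff d (λ _ → 0ℚ) k ≡ 0ℚ
diff-zero zero    k = refl
diff-zero (suc d) k = trans (diff-cong d [1-x]·0 k) (diff-zero d k)
  where
  [1-x]·0 : [1-x]· (λ _ → 0ℚ) ≗ (λ _ → 0ℚ)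
  [1-x]·0 zero    = refl
  [1-x]·0 (suc k) = refl

-- Recurrences over `ℕ` are stated without subtraction, in the form `f = x f + g`; here each becomes
-- multiplication by `1 - x` over `ℚ`.
[1-x]·-shift : ∀ {f g} → (∀ n → f n ≡ shift 1 f n + g n) → [1-x]· (fromℕ ∘ f) ≗ fromℕ ∘ g
[1-x]·-shift {f} {g} eq zero    = trans (cong (λ a → fromℕ a ℚ.- 0ℚ) (eq 0))
  (solve 1 (λ a → a :- con 0ℚ := a) refl (fromℕ (g 0)))
  where open +-*-Solver
[1-x]·-shift {f} {g} eq (suc n) = begin
  fromℕ (f (suc n)) ℚ.- fromℕ (f n)              ≡⟨ cong (λ a → fromℕ a ℚ.- fromℕ (f n)) (eq (suc n)) ⟩
  fromℕ (f n + g (suc n)) ℚ.- fromℕ (f n)        ≡⟨ cong (ℚ._- fromℕ (f n)) (fromℕ-+ (f n) (g (suc n))) ⟩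
  fromℕ (f n) ℚ.+ fromℕ (g (suc n)) ℚ.- fromℕ (f n) ≡⟨ solve 2 (λ a b → a :+ b :- a := b) refl (fromℕ (f n)) (fromℕ (g (suc n))) ⟩
  fromℕ (g (suc n))                              ∎
  where
  open ≡-Reasoning
  open +-*-Solver

fromℕ-shift : ∀ f → fromℕ ∘ shift 1 f ≗ x· (fromℕ ∘ f)
fromℕ-shift f zero    = refl
fromℕ-shift f (suc k) = refl

diff-window : ∀ d {f g : ℕ → ℕ → ℕ} → (∀ τ → diff d (fromℕ ∘ f τ) ≗ fromℕ ∘ g τ) → ∀ a l →
              diff d (λ n → fromℕ (window (λ τ → f τ n) a l)) ≗ (λ n → fromℕ (window (λ τ → g τ n) a l))
diff-window d         eq a zero    k = diff-zero d k
diff-window d {f} {g} eq a (suc l) k = begin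
  diff d (λ n → fromℕ (f a n + window (λ τ → f τ n) (suc a) l)) k
    ≡⟨ diff-cong d (λ n → fromℕ-+ (f a n) _) k ⟩
  diff d (λ n → fromℕ (f a n) ℚ.+ fromℕ (window (λ τ → f τ n) (suc a) l)) k
    ≡⟨ diff-+ d (fromℕ ∘ f a) _ k ⟩
  diff d (fromℕ ∘ f a) k ℚ.+ diff d (λ n → fromℕ (window (λ τ → f τ n) (suc a) l)) k
    ≡⟨ cong₂ ℚ._+_ (eq a k) (diff-window d {f} {g} eq (suc a) l k) ⟩
  fromℕ (g a k) ℚ.+ fromℕ (window (λ τ → g τ k) (suc a) l)
    ≡⟨ fromℕ-+ (g a k) _ ⟨
  fromℕ (g a k + window (λ τ → g τ k) (suc a) l) ∎
  where open ≡-Reasoning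

-- One factor `1 - x` passes through the section as `1 - xʳ` and turns a series of the list for
-- `suc d` into a window of `r * suc d` series of the list for `d`. The remaining factors are
-- distributed over that window.
diff-Φ : ∀ r .{{_ : NonZero r}} d τ → diff (suc d) (λ n → fromℕ (Φ d τ (r * n))) ≗ fromℕ ∘ C r d τ
diff-Φ r zero    τ = [1-x]·-shift (λ n → trans (Φ₀-window r τ (r * n))
  (cong (_+ C r 0 τ n) (shift-section r (Φ 0 τ) n)))
diff-Φ r (suc d) τ k = begin
  diff (suc d) ([1-x]· (λ n → fromℕ (Φ (suc d) τ (r * n)))) k
    ≡⟨ diff-cong (suc d) ([1-x]·-shift recurrence) k ⟩
  diff (suc d) (λ n → fromℕ (window (λ σ → Φ d σ (r * n)) (collapse (suc d) τ) (r * suc d))) k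
    ≡⟨ diff-window (suc d) {λ σ n → Φ d σ (r * n)} {C r d} (diff-Φ r d) (collapse (suc d) τ) (r * suc d) k ⟩
  fromℕ (C r (suc d) τ k) ∎
  where
  open ≡-Reasoning
  recurrence : ∀ n → Φ (suc d) τ (r * n) ≡ shift 1 (λ n → Φ (suc d) τ (r * n)) n +
                     window (λ σ → Φ d σ (r * n)) (collapse (suc d) τ) (r * suc d)
  recurrence n = begin
    Φ (suc d) τ (r * n)
      ≡⟨ Φ-collapse d τ (r * n) ⟩
    Ψ d (collapse (suc d) τ) (r * n)
      ≡⟨ Ψ-window d r (collapse (suc d) τ) (r * n) ⟩
    shift r (Ψ d (collapse (suc d) τ)) (r * n) + W
      ≡⟨ cong (_+ W) (shift-cong r (λ s → sym (Φ-collapse d τ s)) (r * n)) ⟩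
    shift r (Φ (suc d) τ) (r * n) + W
      ≡⟨ cong (_+ W) (shift-section r (Φ (suc d) τ) n) ⟩
    shift 1 (λ n → Φ (suc d) τ (r * n)) n + W ∎
    where
    W : ℕ
    W = window (λ σ → Φ d σ (r * n)) (collapse (suc d) τ) (r * suc d)

-- (x / (1 - x))ⁱ = ∑ₙ (comp i n) xⁿ counts compositions into i positive parts.
comp : ℕ → ℕ → ℕ
comp zero    zero    = 1
comp zero    (suc n) = 0
comp (suc i) zero    = 0
comp (suc i) (suc n) = comp i n + comp (suc i) n

comp-vanishes : ∀ {i n} → n < i → comp i n ≡ 0
comp-vanishes {suc i} {zero}  _         = refl
comp-vanishes {suc i} {suc n} (s≤s n<i) =
  cong₂ _+_ (comp-vanishes n<i) (comp-vanishes (m≤n⇒m≤1+n n<i))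

-- Each of the `i` factors x / (1 - x) uses up one `1 - x` and leaves an x.
diff-comp : ∀ {d i} → i ≤ d → diff d (fromℕ ∘ comp i) ≗ (x^ i ·[1-x]^ (d ∸ i))
diff-comp {d} z≤n k = trans (diff-cong d (λ { zero → refl ; (suc _) → refl }) k) (powers d k)
  where
  powers : ∀ d → diff d 1ₚ ≗ (x^ 0 ·[1-x]^ d)
  powers zero    k = refl
  powers (suc d) k = trans (diff-[1-x] d 1ₚ k) ([1-x]·-cong (λ {i} _ → powers d i))
diff-comp {suc d} {suc i} (s≤s i≤d) k = begin
  diff d ([1-x]· (fromℕ ∘ comp (suc i))) k  ≡⟨ diff-cong d ([1-x]·-shift recurrence) k ⟩
  diff d (fromℕ ∘ shift 1 (comp i)) k       ≡⟨ diff-cong d (fromℕ-shift (comp i)) k ⟩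
  diff d (x· (fromℕ ∘ comp i)) k            ≡⟨ diff-x d _ k ⟩
  (x· (diff d (fromℕ ∘ comp i))) k          ≡⟨ x·-cong (diff-comp i≤d) k ⟩
  (x· (x^ i ·[1-x]^ (d ∸ i))) k             ∎
  where
  open ≡-Reasoning
  recurrence : ∀ n → comp (suc i) n ≡ shift 1 (comp (suc i)) n + shift 1 (comp i) n
  recurrence zero    = refl
  recurrence (suc n) = +-comm (comp i n) (comp (suc i) n)

-- Face numbers and multisets

count : {P : A → Set} → Decidable P → List A → ℕ
count P? xs = length (filter P? xs)

module _ {P : B → Set} (P? : Decidable P) where

  count-++ : ∀ xs ys → count P? (xs ++ ys) ≡ count P? xs + count P? ys
  count-++ xs ys = trans (cong length (filter-++ P? xs ys)) (length-++ (filter P? xs))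

  count-∷ : ∀ x xs → count P? (x ∷ xs) ≡ (if does (P? x) then 1 else 0) + count P? xs
  count-∷ x xs with does (P? x)
  ... | true  = refl
  ... | false = refl

  count-map : ∀ (f : A → B) xs → count P? (map f xs) ≡ count (λ x → P? (f x)) xs
  count-map f []       = refl
  count-map f (x ∷ xs) with does (P? (f x))
  ... | true  = cong suc (count-map f xs)
  ... | false = count-map f xs

increment : ∀ {g} → Vec ℕ (suc g) → Vec ℕ (suc g)
increment u = suc (head u) ∷ tail u

-- Exponent vectors of the monomials of degree `n` in `g` variables: the first variable is either
-- absent or can be divided out once.
weakCompositions : (g n : ℕ) → List (Vec ℕ g)
weakCompositions zero    zero    = [] ∷ []
weakCompositions zero    (suc n) = []
weakCompositions (suc g) zero    = map (0 ∷_) (weakCompositions g zero)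
weakCompositions (suc g) (suc n) =
  map (0 ∷_) (weakCompositions g (suc n)) ++ map increment (weakCompositions (suc g) n)

weightedSum : (A → Bool) → (A → ℕ) → List A → ℕ
weightedSum φ w xs = sum (map (λ x → if φ x then w x else 0) xs)

weightedSum-++ : ∀ (φ : A → Bool) w xs ys →
                 weightedSum φ w (xs ++ ys) ≡ weightedSum φ w xs + weightedSum φ w ys
weightedSum-++ φ w xs ys = trans (cong sum (map-++ _ xs ys)) (sum-++ (map _ xs) _)

weightedSum-map : ∀ (φ : B → Bool) w (f : A → B) xs →
                  weightedSum φ w (map f xs) ≡ weightedSum (φ ∘ f) (w ∘ f) xs
weightedSum-map φ w f xs = cong sum (sym (map-∘ xs))

weightedSum-zero : ∀ (φ : A → Bool) xs → weightedSum φ (λ _ → 0) xs ≡ 0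
weightedSum-zero φ []       = refl
weightedSum-zero φ (x ∷ xs) with φ x
... | true  = weightedSum-zero φ xs
... | false = weightedSum-zero φ xs

weightedSum-+ : ∀ (φ : A → Bool) v w xs →
                weightedSum φ (λ x → v x + w x) xs ≡ weightedSum φ v xs + weightedSum φ w xs
weightedSum-+ φ v w []       = refl
weightedSum-+ φ v w (x ∷ xs) with φ x
... | true  = trans (cong (v x + w x +_) (weightedSum-+ φ v w xs))
                (interchange (v x) (w x) (weightedSum φ v xs) (weightedSum φ w xs))
... | false = weightedSum-+ φ v w xs

weightedSum-subsets : ∀ {g} (φ : Subset (suc g) → Bool) w →
  weightedSum φ w (subsets (suc g)) ≡
  weightedSum (φ ∘ (outside ∷_)) (w ∘ (outside ∷_)) (subsets g) +
  weightedSum (φ ∘ (inside ∷_)) (w ∘ (inside ∷_)) (subsets g)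
weightedSum-subsets {g} φ w = begin
  weightedSum φ w (map (outside ∷_) S ++ map (inside ∷_) S ++ [])
    ≡⟨ cong (λ xs → weightedSum φ w (map (outside ∷_) S ++ xs)) (++-identityʳ (map (inside ∷_) S)) ⟩
  weightedSum φ w (map (outside ∷_) S ++ map (inside ∷_) S)
    ≡⟨ weightedSum-++ φ w (map (outside ∷_) S) _ ⟩
  weightedSum φ w (map (outside ∷_) S) + weightedSum φ w (map (inside ∷_) S)
    ≡⟨ cong₂ _+_ (weightedSum-map φ w (outside ∷_) S) (weightedSum-map φ w (inside ∷_) S) ⟩
  weightedSum (φ ∘ (outside ∷_)) (w ∘ (outside ∷_)) S + weightedSum (φ ∘ (inside ∷_)) (w ∘ (inside ∷_)) S ∎
  where
  open ≡-Reasoning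
  S : List (Subset g)
  S = subsets g

-- Vectors are grouped by support: the nonzero entries of a vector with support `S` form a
-- composition into `∣ S ∣` positive parts.
count-weakCompositions : ∀ g {P : Subset g → Set} (P? : Decidable P) n →
  count (P? ∘ support) (weakCompositions g n) ≡
  weightedSum (does ∘ P?) (λ S → comp ∣ S ∣ n) (subsets g)
count-weakCompositions zero P? zero with does (P? [])
... | true  = refl
... | false = refl
count-weakCompositions zero P? (suc n) with does (P? [])
... | true  = refl
... | false = refl
count-weakCompositions (suc g) P? zero = begin
  count (P? ∘ support) (map (0 ∷_) (weakCompositions g 0))
    ≡⟨ count-map (P? ∘ support) (0 ∷_) (weakCompositions g 0) ⟩
  count (P? ∘ (outside ∷_) ∘ support) (weakCompositions g 0)
    ≡⟨ count-weakCompositions g (P? ∘ (outside ∷_)) 0 ⟩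
  weightedSum (does ∘ P? ∘ (outside ∷_)) (λ S → comp ∣ S ∣ 0) (subsets g)
    ≡⟨ +-identityʳ _ ⟨
  weightedSum (does ∘ P? ∘ (outside ∷_)) (λ S → comp ∣ S ∣ 0) (subsets g) + 0
    ≡⟨ cong (weightedSum (does ∘ P? ∘ (outside ∷_)) (λ S → comp ∣ S ∣ 0) (subsets g) +_)
            (weightedSum-zero (does ∘ P? ∘ (inside ∷_)) (subsets g)) ⟨
  _ ≡⟨ weightedSum-subsets (does ∘ P?) (λ S → comp ∣ S ∣ 0) ⟨
  weightedSum (does ∘ P?) (λ S → comp ∣ S ∣ 0) (subsets (suc g)) ∎
  where open ≡-Reasoning
count-weakCompositions (suc g) {P} P? (suc n) = begin
  count (P? ∘ support) (weakCompositions (suc g) (suc n))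
    ≡⟨ count-++ (P? ∘ support) (map (0 ∷_) (weakCompositions g (suc n))) _ ⟩
  _ ≡⟨ cong₂ _+_ (count-map (P? ∘ support) (0 ∷_) (weakCompositions g (suc n)))
                 (count-map (P? ∘ support) increment (weakCompositions (suc g) n)) ⟩
  count (P? ∘ (outside ∷_) ∘ support) (weakCompositions g (suc n)) +
  count (P? ∘ support ∘ increment) (weakCompositions (suc g) n)
    ≡⟨ cong₂ _+_ (count-weakCompositions g (P? ∘ (outside ∷_)) (suc n)) (positive n) ⟩
  weightedSum (does ∘ P? ∘ (outside ∷_)) (λ S → comp ∣ S ∣ (suc n)) (subsets g) +
  weightedSum (does ∘ P? ∘ (inside ∷_)) (λ S → comp (suc ∣ S ∣) (suc n)) (subsets g)
    ≡⟨ weightedSum-subsets (does ∘ P?) (λ S → comp ∣ S ∣ (suc n)) ⟨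
  weightedSum (does ∘ P?) (λ S → comp ∣ S ∣ (suc n)) (subsets (suc g)) ∎
  where
  open ≡-Reasoning
  φ : Subset g → Bool
  φ = does ∘ P? ∘ (inside ∷_)
  -- After `increment` the first element is in the support whatever its entry was before, so only
  -- the tail is tested. A previous entry that is zero or positive gives the two terms in the
  -- recursion of `comp`.
  positive : ∀ n → count (P? ∘ support ∘ increment) (weakCompositions (suc g) n) ≡
             weightedSum φ (λ S → comp (suc ∣ S ∣) (suc n)) (subsets g)
  positive zero = begin
    count (P? ∘ support ∘ increment) (map (0 ∷_) (weakCompositions g 0))
      ≡⟨ count-map (P? ∘ support ∘ increment) (0 ∷_) (weakCompositions g 0) ⟩
    count (P? ∘ (inside ∷_) ∘ support) (weakCompositions g 0)
      ≡⟨ count-weakCompositions g (P? ∘ (inside ∷_)) 0 ⟩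
    weightedSum φ (λ S → comp ∣ S ∣ 0) (subsets g)
      ≡⟨ cong sum (map-cong (λ S → cong (λ c → if φ S then c else 0) (sym (+-identityʳ (comp ∣ S ∣ 0)))) (subsets g)) ⟩
    weightedSum φ (λ S → comp (suc ∣ S ∣) 1) (subsets g) ∎
  positive (suc n) = begin
    count (P? ∘ support ∘ increment) (weakCompositions (suc g) (suc n))
      ≡⟨ count-++ (P? ∘ support ∘ increment) (map (0 ∷_) (weakCompositions g (suc n))) _ ⟩
    _ ≡⟨ cong₂ _+_ (count-map (P? ∘ support ∘ increment) (0 ∷_) (weakCompositions g (suc n)))
                   (count-map (P? ∘ support ∘ increment) increment (weakCompositions (suc g) n)) ⟩
    count (P? ∘ (inside ∷_) ∘ support) (weakCompositions g (suc n)) +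
    count (P? ∘ support ∘ increment) (weakCompositions (suc g) n)
      ≡⟨ cong₂ _+_ (count-weakCompositions g (P? ∘ (inside ∷_)) (suc n)) (positive n) ⟩
    _ ≡⟨ weightedSum-+ φ (λ S → comp ∣ S ∣ (suc n)) (λ S → comp (suc ∣ S ∣) (suc n)) (subsets g) ⟨
    weightedSum φ (λ S → comp (suc ∣ S ∣) (suc (suc n))) (subsets g) ∎

∑-delta : ∀ {n} s (q : ℕ → ℕ) → (∀ {i} → n ≤ i → q i ≡ 0) →
          ∑ {n} (λ i → fromℕ (if does (s ≟ toℕ i) then 1 else 0) ℚ.* fromℕ (q (toℕ i))) ≡ fromℕ (q s)
∑-delta {zero}  s       q vanish = cong fromℕ (sym (vanish z≤n))
∑-delta {suc n} zero    q vanish = trans (cong₂ ℚ._+_ (ℚ.*-identityˡ (fromℕ (q 0)))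
  (∑-zero {n} (λ i → ℚ.*-zeroˡ (fromℕ (q (suc (toℕ i))))))) (ℚ.+-identityʳ (fromℕ (q 0)))
∑-delta {suc n} (suc s) q vanish = trans (cong₂ ℚ._+_ (ℚ.*-zeroˡ (fromℕ (q 0)))
  (∑-delta s (q ∘ suc) (vanish ∘ s≤s))) (ℚ.+-identityˡ (fromℕ (q (suc s))))

-- Summation over sizes is exchanged with summation over members. Members of size at least `n` are
-- missed by the left side, and `vanish` gives them weight 0 on the right.
∑-count : ∀ {n} {P : A → Set} (P? : Decidable P) (size : A → ℕ) (q : ℕ → ℕ) →
          (∀ {i} → n ≤ i → q i ≡ 0) → ∀ xs →
          ∑ {n} (λ i → fromℕ (count (λ x → P? x ×-dec (size x ≟ toℕ i)) xs) ℚ.* fromℕ (q (toℕ i)))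
          ≡ fromℕ (weightedSum (does ∘ P?) (q ∘ size) xs)
∑-count {n = n} P? size q vanish [] = ∑-zero {n} (λ i → ℚ.*-zeroˡ (fromℕ (q (toℕ i))))
∑-count {n = n} P? size q vanish (x ∷ xs) = begin
  ∑ {n} (λ i → fromℕ (count (Q? i) (x ∷ xs)) ℚ.* fromℕ (q (toℕ i)))
    ≡⟨ ∑-cong {n} split ⟩
  ∑ {n} (λ i → fromℕ ([x∈Q] i) ℚ.* fromℕ (q (toℕ i)) ℚ.+ fromℕ (count (Q? i) xs) ℚ.* fromℕ (q (toℕ i)))
    ≡⟨ ∑-+ {n} (λ i → fromℕ ([x∈Q] i) ℚ.* fromℕ (q (toℕ i))) _ ⟩
  _ ≡⟨ cong₂ ℚ._+_ ∑-[x∈Q] (∑-count P? size q vanish xs) ⟩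
  fromℕ (if does (P? x) then q (size x) else 0) ℚ.+ fromℕ (weightedSum (does ∘ P?) (q ∘ size) xs)
    ≡⟨ fromℕ-+ (if does (P? x) then q (size x) else 0) _ ⟨
  fromℕ (weightedSum (does ∘ P?) (q ∘ size) (x ∷ xs)) ∎
  where
  open ≡-Reasoning
  Q? : (i : Fin n) → Decidable _
  Q? i x = P? x ×-dec (size x ≟ toℕ i)
  [x∈Q] : Fin n → ℕ
  [x∈Q] i = if does (Q? i x) then 1 else 0
  split : ∀ i → fromℕ (count (Q? i) (x ∷ xs)) ℚ.* fromℕ (q (toℕ i)) ≡
                fromℕ ([x∈Q] i) ℚ.* fromℕ (q (toℕ i)) ℚ.+ fromℕ (count (Q? i) xs) ℚ.* fromℕ (q (toℕ i))
  split i = trans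
    (cong (ℚ._* fromℕ (q (toℕ i))) (trans (cong fromℕ (count-∷ (Q? i) x xs)) (fromℕ-+ ([x∈Q] i) _)))
    (ℚ.*-distribʳ-+ (fromℕ (q (toℕ i))) (fromℕ ([x∈Q] i)) (fromℕ (count (Q? i) xs)))
  ∑-[x∈Q] : ∑ {n} (λ i → fromℕ ([x∈Q] i) ℚ.* fromℕ (q (toℕ i))) ≡ fromℕ (if does (P? x) then q (size x) else 0)
  ∑-[x∈Q] with does (P? x)
  ... | true  = ∑-delta {n} (size x) q vanish
  ... | false = ∑-zero {n} (λ i → ℚ.*-zeroˡ (fromℕ (q (toℕ i))))

-- Monomials of degree n in the Stanley–Reisner ring of Δ.
multisets : SimplicialComplex → ℕ → ℕ
multisets Δ n = count (face? Δ ∘ support) (weakCompositions (ground Δ) n)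

hVector-multisets : ∀ d Δ (k : Fin (suc d)) → hVector d Δ k ≡ diff d (fromℕ ∘ multisets Δ) (toℕ k)
hVector-multisets d Δ k = begin
  hVector d Δ k
    ≡⟨ ∑-cong {suc d} (λ i → cong (fromℕ (faceCount Δ (toℕ i)) ℚ.*_) (diff-comp (toℕ≤pred[n] i) (toℕ k))) ⟨
  ∑ {suc d} (λ i → fromℕ (faceCount Δ (toℕ i)) ℚ.* diff d (fromℕ ∘ comp (toℕ i)) (toℕ k))
    ≡⟨ diff-∑ d {suc d} (λ i → fromℕ (faceCount Δ (toℕ i))) (λ i → fromℕ ∘ comp (toℕ i)) (toℕ k) ⟨
  diff d (λ n → ∑ {suc d} (λ i → fromℕ (faceCount Δ (toℕ i)) ℚ.* fromℕ (comp (toℕ i) n))) (toℕ k)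
    -- Faces with more than `d` elements do not enter `hVector d`. They support no multiset of
    -- degree `n ≤ k ≤ d`, and the coefficient at `k` depends only on these degrees.
    ≡⟨ diff-cong-≤ d (λ {n} n≤k → trans
         (∑-count {n = suc d} (face? Δ) ∣_∣ (λ i → comp i n)
           (λ d<i → comp-vanishes (≤-trans (s≤s (≤-trans n≤k (toℕ≤pred[n] k))) d<i)) (subsets (ground Δ)))
         (cong fromℕ (sym (count-weakCompositions (ground Δ) (face? Δ) n)))) ⟩
  diff d (fromℕ ∘ multisets Δ) (toℕ k) ∎
  where open ≡-Reasoning

-- Counting by bijections between duplicate-free lists

length-≡-by-bijection : {xs : List A} {ys : List B} → Unique xs → Unique ys → (f : A → B) →
  (∀ {x} → x ∈ xs → f x ∈ ys) →
  (∀ {x x′} → x ∈ xs → x′ ∈ xs → f x ≡ f x′ → x ≡ x′) →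
  (∀ {y} → y ∈ ys → ∃ λ x → x ∈ xs × f x ≡ y) →
  length xs ≡ length ys
length-≡-by-bijection {xs = xs} {ys} xs! ys! f into inj onto = trans (sym (length-map f xs))
  (↭-length (∼bag⇒↭ (unique∧set⇒bag (map! xs! inj) ys! (mk⇔ to from))))
  where
  map! : ∀ {xs} → Unique xs → (∀ {x x′} → x ∈ xs → x′ ∈ xs → f x ≡ f x′ → x ≡ x′) → Unique (map f xs)
  map! []           _   = []
  map! (x∉xs ∷ xs!) inj =
    All.map⁺ (All.tabulate (λ x′∈xs fx≡fx′ → All.lookup x∉xs x′∈xs (inj (here refl) (there x′∈xs) fx≡fx′)))
    ∷ map! xs! (λ x∈ x′∈ → inj (there x∈) (there x′∈))
  to : ∀ {y} → y ∈ map f xs → y ∈ ys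
  to y∈ with ∈-map⁻ f y∈
  ... | x , x∈xs , refl = into x∈xs
  from : ∀ {y} → y ∈ ys → y ∈ map f xs
  from y∈ with onto y∈
  ... | x , x∈xs , refl = ∈-map⁺ f x∈xs

data Lex {A : Set} (_<_ : Rel A 0ℓ) : ∀ {n} → Rel (Vec A n) 0ℓ where
  this : ∀ {n a b} {u w : Vec A n} → a < b → Lex _<_ (a ∷ u) (b ∷ w)
  next : ∀ {n a} {u w : Vec A n} → Lex _<_ u w → Lex _<_ (a ∷ u) (a ∷ w)

-- The order of enumeration matters beyond distinctness: seen through `ι` or `χ`, it is compatible
-- with the order of chains, so reading a face along the list sorts it.
vectors-lex : {_<_ : Rel A 0ℓ} {xs : List A} → AllPairs _<_ xs → ∀ n → AllPairs (Lex _<_) (vectors xs n)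
vectors-lex              xs< zero    = [] ∷ []
vectors-lex {A} {_<_} {xs} xs< (suc n) = go xs<
  where
  tails : AllPairs (Lex _<_) (vectors xs n)
  tails = vectors-lex xs< n
  go : ∀ {ys} → AllPairs _<_ ys → AllPairs (Lex _<_) (cartesianProductWith _∷_ ys (vectors xs n))
  go []                     = []
  go {y ∷ ys} (y<ys ∷ ys<) = AllPairs.++⁺ (AllPairs.map⁺ (AllPairs.map next tails)) (go ys<)
    (All.map⁺ (All.tabulate (λ _ → All.tabulate (λ z∈ → first z∈))))
    where
    first : ∀ {u z} → z ∈ cartesianProductWith _∷_ ys (vectors xs n) → Lex _<_ (y ∷ u) z
    first z∈ with ∈-cartesianProductWith⁻ _∷_ ys (vectors xs n) z∈
    ... | a , w , a∈ys , _ , refl = this (All.lookup y<ys a∈ys)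

upTo-< : ∀ n → AllPairs _<_ (upTo n)
upTo-< n = AllPairs.applyUpTo⁺₁ _ n (λ i<j _ → i<j)

lex-irrefl : {u w : Vec ℕ g} → Lex _<_ u w → u ≢ w
lex-irrefl (this a<a) refl = <-irrefl refl a<a
lex-irrefl (next u<u) refl = lex-irrefl u<u refl

vectors-unique : ∀ m g → Unique (vectors (upTo m) g)
vectors-unique m g = AllPairs.map lex-irrefl (vectors-lex (upTo-< m) g)

∈-vectors⁺ : ∀ {xs : List A} {n} {u : Vec A n} → (∀ i → Vec.lookup u i ∈ xs) → u ∈ vectors xs n
∈-vectors⁺ {u = []}    u∈ = here refl
∈-vectors⁺ {u = a ∷ u} u∈ = ∈-cartesianProductWith⁺ _∷_ (u∈ Fin.zero) (∈-vectors⁺ (u∈ ∘ Fin.suc))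

∈-vectors⁻ : ∀ {xs : List A} {n} {u : Vec A n} → u ∈ vectors xs n → ∀ i → Vec.lookup u i ∈ xs
∈-vectors⁻ {xs = xs} {suc n} u∈ i with ∈-cartesianProductWith⁻ _∷_ xs (vectors xs n) u∈
∈-vectors⁻ u∈ Fin.zero    | a , u , a∈xs , _ , refl = a∈xs
∈-vectors⁻ u∈ (Fin.suc i) | a , u , _ , u∈′ , refl = ∈-vectors⁻ u∈′ i

∈-weakCompositions⁺ : (u : Vec ℕ g) → u ∈ weakCompositions g (Vec.sum u)
∈-weakCompositions⁺ []          = here refl
∈-weakCompositions⁺ (zero ∷ u)  with Vec.sum u | ∈-weakCompositions⁺ u
... | zero  | u∈ = ∈-map⁺ (0 ∷_) u∈
... | suc n | u∈ = ∈-++⁺ˡ (∈-map⁺ (0 ∷_) u∈)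
∈-weakCompositions⁺ {suc g} (suc a ∷ u) = ∈-++⁺ʳ (map (0 ∷_) (weakCompositions g (suc (a + Vec.sum u))))
  (∈-map⁺ increment (∈-weakCompositions⁺ (a ∷ u)))

∈-weakCompositions⁻ : ∀ g n {u} → u ∈ weakCompositions g n → Vec.sum u ≡ n
∈-weakCompositions⁻ zero    zero    (here refl) = refl
∈-weakCompositions⁻ (suc g) zero    u∈ with ∈-map⁻ (0 ∷_) u∈
... | v , v∈ , refl = ∈-weakCompositions⁻ g zero v∈
∈-weakCompositions⁻ (suc g) (suc n) u∈ with ∈-++⁻ (map (0 ∷_) (weakCompositions g (suc n))) u∈
... | inj₁ u∈₀ with ∈-map⁻ (0 ∷_) u∈₀
...   | v , v∈ , refl = ∈-weakCompositions⁻ g (suc n) v∈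
∈-weakCompositions⁻ (suc g) (suc n) u∈ | inj₂ u∈₁ with ∈-map⁻ increment u∈₁
...   | a ∷ v , v∈ , refl = cong suc (∈-weakCompositions⁻ (suc g) n v∈)

weakCompositions-unique : ∀ g n → Unique (weakCompositions g n)
weakCompositions-unique zero    zero    = [] ∷ []
weakCompositions-unique zero    (suc n) = []
weakCompositions-unique (suc g) zero    =
  AllPairs.map⁺ (AllPairs.map (λ u≢w → u≢w ∘ Vec.∷-injectiveʳ) (weakCompositions-unique g zero))
weakCompositions-unique (suc g) (suc n) = AllPairs.++⁺
  (AllPairs.map⁺ (AllPairs.map (λ u≢w → u≢w ∘ Vec.∷-injectiveʳ) (weakCompositions-unique g (suc n))))
  (AllPairs.map⁺ (AllPairs.map (λ u≢w → u≢w ∘ increment-injective) (weakCompositions-unique (suc g) n)))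
  (All.map⁺ (All.tabulate (λ _ → All.map⁺ (All.tabulate (λ _ ())))))
  where
  increment-injective : ∀ {g} {u w : Vec ℕ (suc g)} → increment u ≡ increment w → u ≡ w
  increment-injective {u = _ ∷ _} {_ ∷ _} refl = refl

-- Multisets of list members as sorted chains

expand : (L : List A) → Vec ℕ (length L) → List A
expand []      []      = []
expand (x ∷ L) (k ∷ u) = replicate k x ++ expand L u

length-expand : (L : List A) (u : Vec ℕ (length L)) → length (expand L u) ≡ Vec.sum u
length-expand []      []      = refl
length-expand (x ∷ L) (k ∷ u) =
  trans (length-++ (replicate k x)) (cong₂ _+_ (length-replicate k) (length-expand L u))

∈-expand⁺ : (L : List A) (u : Vec ℕ (length L)) → ∀ {i} → i Subset.∈ support u → List.lookup L i ∈ expand L u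
∈-expand⁺ (x ∷ L) (suc k ∷ u) {Fin.zero}  here      = here refl
∈-expand⁺ (x ∷ L) (k ∷ u)     {Fin.suc i} (there i∈) = ∈-++⁺ʳ (replicate k x) (∈-expand⁺ L u i∈)

∈-expand⁻ : (L : List A) (u : Vec ℕ (length L)) → ∀ {z} → z ∈ expand L u →
            ∃ λ i → i Subset.∈ support u × List.lookup L i ≡ z
∈-expand⁻ []      []          ()
∈-expand⁻ (x ∷ L) (suc k ∷ u) (here refl) = Fin.zero , here , refl
∈-expand⁻ (x ∷ L) (suc k ∷ u) (there z∈) with ∈-expand⁻ (x ∷ L) (k ∷ u) z∈
... | Fin.zero  , _        , eq = Fin.zero , here , eq
... | Fin.suc i , there i∈ , eq = Fin.suc i , there i∈ , eq
∈-expand⁻ (x ∷ L) (zero ∷ u) z∈ with ∈-expand⁻ L u z∈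
... | i , i∈ , eq = Fin.suc i , there i∈ , eq

expand-⊆ : (L : List A) (u : Vec ℕ (length L)) → ∀ {z} → z ∈ expand L u → z ∈ L
expand-⊆ L u z∈ with ∈-expand⁻ L u z∈
... | i , _ , refl = ∈-lookup i

expand-injective : {L : List A} → Unique L → ∀ u w → expand L u ≡ expand L w → u ≡ w
expand-injective {L = []}    _            []           []           _  = refl
expand-injective {L = x ∷ L} (x∉L ∷ L!)  (zero ∷ u)  (zero ∷ w)  eq = cong (0 ∷_) (expand-injective L! u w eq)
expand-injective {L = x ∷ L} L!           (suc k ∷ u) (suc l ∷ w) eq
  with refl ← expand-injective L! (k ∷ u) (l ∷ w) (∷-injectiveʳ eq) = refl
expand-injective {L = x ∷ L} (x∉L ∷ _)   (zero ∷ u)  (suc l ∷ w) eq =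
  ⊥-elim (All.lookup x∉L (expand-⊆ L u (subst (x ∈_) (sym eq) (here refl))) refl)
expand-injective {L = x ∷ L} (x∉L ∷ _)   (suc k ∷ u) (zero ∷ w)  eq =
  ⊥-elim (All.lookup x∉L (expand-⊆ L w (subst (x ∈_) eq (here refl))) refl)

-- For reflexive `R`, a pairwise comparable multiset of members, expanded in the order of such a
-- list, is a chain, and every chain of members arises from exactly one multiset.
LinearExtension : Rel A 0ℓ → List A → Set
LinearExtension R = AllPairs (λ x y → ¬ R y x)

module _ {R : Rel A 0ℓ} (R-refl : Reflexive R) where

  linearExtension-unique : {L : List A} → LinearExtension R L → Unique L
  linearExtension-unique = AllPairs.map (λ {x} ¬Ryx x≡y → ¬Ryx (subst (λ y → R y x) x≡y R-refl))

  expand-chain : {L : List A} → LinearExtension R L → (u : Vec ℕ (length L)) →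
    (∀ i j → i Subset.∈ support u → j Subset.∈ support u →
     R (List.lookup L i) (List.lookup L j) ⊎ R (List.lookup L j) (List.lookup L i)) →
    AllPairs R (expand L u)
  expand-chain {[]}    _          []          _    = []
  expand-chain {x ∷ L} (_ ∷ ext)  (zero ∷ u)  comparable =
    expand-chain ext u (λ i j i∈ j∈ → comparable (Fin.suc i) (Fin.suc j) (there i∈) (there j∈))
  expand-chain {x ∷ L} (¬x ∷ ext) (suc k ∷ u) comparable =
    All.tabulate below ∷ expand-chain (¬x ∷ ext) (k ∷ u) (λ i j i∈ j∈ → comparable i j (weaken i∈) (weaken j∈))
    where
    weaken : ∀ {i} → i Subset.∈ support (k ∷ u) → i Subset.∈ support (suc k ∷ u)
    weaken {Fin.zero}  _          = here
    weaken {Fin.suc i} (there i∈) = there i∈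
    below : ∀ {z} → z ∈ expand (x ∷ L) (k ∷ u) → R x z
    below z∈ with ∈-expand⁻ (x ∷ L) (k ∷ u) z∈
    ... | Fin.zero  , _  , refl = R-refl
    ... | Fin.suc i , i∈ , refl with comparable Fin.zero (Fin.suc i) here (weaken i∈)
    ...   | inj₁ Rxz = Rxz
    ...   | inj₂ Rzx = ⊥-elim (All.lookup ¬x (∈-lookup {xs = L} i) Rzx)

  chain-comparable : ∀ {X x y} → AllPairs R X → x ∈ X → y ∈ X → R x y ⊎ R y x
  chain-comparable (_ ∷ _)  (here refl) (here refl) = inj₁ R-refl
  chain-comparable (Rx ∷ _) (here refl) (there y∈)  = inj₁ (All.lookup Rx y∈)
  chain-comparable (Ry ∷ _) (there x∈)  (here refl) = inj₂ (All.lookup Ry x∈)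
  chain-comparable (_ ∷ RX) (there x∈)  (there y∈)  = chain-comparable RX x∈ y∈

expand-surjective : {R : Rel A 0ℓ} {L X : List A} → LinearExtension R L → All (_∈ L) X → AllPairs R X →
                    ∃ λ u → expand L u ≡ X
expand-surjective {L = []}    {[]}    _          _                 _          = [] , refl
expand-surjective {L = []}    {_ ∷ _} _          (() ∷ _)          _
expand-surjective {L = x ∷ L} {[]}    (_ ∷ ext)  _                 _          with expand-surjective ext [] []
... | u , eq = 0 ∷ u , eq
expand-surjective {L = x ∷ L} {y ∷ X} ext        (here refl ∷ X∈)  (_ ∷ RX)   with expand-surjective ext X∈ RX
... | k ∷ u , refl = suc k ∷ u , refl
expand-surjective {L = x ∷ L} {y ∷ X} (¬x ∷ ext) (there y∈L ∷ X∈) (Ry ∷ RX)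
  with expand-surjective ext (y∈L ∷ All.zipWith drop (X∈ , Ry)) (Ry ∷ RX)
  where
  -- Since `x` precedes `y` in the list, `R y x` is excluded; so `x` cannot occur after `y` in the
  -- chain and gets multiplicity 0.
  drop : ∀ {z} → z ∈ x ∷ L × _ → z ∈ L
  drop (here refl , Ryx) = ⊥-elim (All.lookup ¬x y∈L Ryx)
  drop (there z∈L , _)   = z∈L
... | u , eq = 0 ∷ u , eq

-- Sums of chains of vectors

_⊕_ : Vec ℕ g → Vec ℕ g → Vec ℕ g
_⊕_ = zipWith _+_

vsum : List (Vec ℕ g) → Vec ℕ g
vsum = List.foldr _⊕_ (Vec.replicate _ 0)

-- This relation is not transitive (0, 1, 2 in one coordinate), so a chain has to relate all pairs
-- and not only neighbours; hence `AllPairs`.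
_≼_ : Rel (Vec ℕ g) 0ℓ
x ≼ y = y -01- x

⊕-cancelˡ : ∀ (x : Vec ℕ g) {y z} → x ⊕ y ≡ x ⊕ z → y ≡ z
⊕-cancelˡ []      {[]}    {[]}    _  = refl
⊕-cancelˡ (a ∷ x) {b ∷ y} {c ∷ z} eq =
  cong₂ _∷_ (+-cancelˡ-≡ a b c (Vec.∷-injectiveˡ eq)) (⊕-cancelˡ x (Vec.∷-injectiveʳ eq))

-- The members of a chain are the roundings of its mean value.
chain-head : ∀ {x : Vec ℕ g} {X} → All (x ≼_) X → Vec.map (_/ suc (length X)) (vsum (x ∷ X)) ≡ x
chain-head {x = x} {X} x≼X = round (bounds x≼X)
  where
  n : ℕ
  n = length X
  -- Each of the `n` later members exceeds the entry `a` by 0 or 1, so the full sum is `suc n * a`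
  -- plus an excess of at most `n`, and division by `suc n` returns `a`.
  Bounded : ℕ → ℕ → ℕ → Set
  Bounded n a s = n * a ≤ s × s ≤ n + n * a
  base : ∀ {g} (x : Vec ℕ g) → Pointwise (Bounded 0) x (Vec.replicate g 0)
  base []      = []
  base (_ ∷ x) = (z≤n , z≤n) ∷ base x
  step : ∀ {g n} {x y s : Vec ℕ g} → x ≼ y → Pointwise (Bounded n) x s → Pointwise (Bounded (suc n)) x (y ⊕ s)
  step []                  []                 = []
  step {n = n} {x = a ∷ _} (inj₁ refl ∷ x≼y) ((lo , hi) ∷ bs) =
    (+-monoʳ-≤ a lo , ≤-trans (+-monoʳ-≤ a hi) (≤-trans (≤-reflexive (x∙yz≈y∙xz a n (n * a))) (n≤1+n _))) ∷ step {n = n} x≼y bs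
  step {n = n} {x = a ∷ _} (inj₂ refl ∷ x≼y) ((lo , hi) ∷ bs) =
    (≤-trans (+-monoʳ-≤ a lo) (n≤1+n _) , s≤s (≤-trans (+-monoʳ-≤ a hi) (≤-reflexive (x∙yz≈y∙xz a n (n * a))))) ∷ step {n = n} x≼y bs
  bounds : ∀ {X} → All (x ≼_) X → Pointwise (Bounded (length X)) x (vsum X)
  bounds []            = base x
  bounds {_ ∷ X} (x≼y ∷ x≼X) = step {n = length X} x≼y (bounds x≼X)
  round : ∀ {g} {x s : Vec ℕ g} → Pointwise (Bounded n) x s → Vec.map (_/ suc n) (x ⊕ s) ≡ x
  round []                                   = refl
  round {x = a ∷ _} {s ∷ _} ((lo , hi) ∷ bs) = cong₂ _∷_ (begin
    (a + s) / suc n                     ≡⟨ cong (λ s → (a + s) / suc n) (m∸n+n≡m lo) ⟨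
    (a + (s ∸ n * a + n * a)) / suc n   ≡⟨ cong (_/ suc n) (x∙yz≈y∙xz a (s ∸ n * a) (n * a)) ⟩
    (s ∸ n * a + suc n * a) / suc n     ≡⟨ cong (λ z → (s ∸ n * a + z) / suc n) (*-comm (suc n) a) ⟩
    (s ∸ n * a + a * suc n) / suc n     ≡⟨ [j+t*n]/n≡t a (s≤s (m≤n+o⇒m∸o≤n s n hi)) ⟩
    a                                   ∎) (round bs)
    where
    open ≡-Reasoning
    m≤n+o⇒m∸o≤n : ∀ s n {o} → s ≤ n + o → s ∸ o ≤ n
    m≤n+o⇒m∸o≤n s n {o} s≤ = ≤-trans (∸-monoˡ-≤ o s≤) (≤-reflexive (m+n∸n≡m n o))

-- Length and sum determine the head by `chain-head`; cancelling it leaves two shorter chains of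
-- equal length and sum.
chain-sum-injective : {X Y : List (Vec ℕ g)} → AllPairs _≼_ X → AllPairs _≼_ Y →
                      length X ≡ length Y → vsum X ≡ vsum Y → X ≡ Y
chain-sum-injective {X = []}    {[]}    _            _            _   _   = refl
chain-sum-injective {X = x ∷ X} {y ∷ Y} (x≼X ∷ X≼) (y≼Y ∷ Y≼) len eq = cong₂ _∷_ x≡y
  (chain-sum-injective X≼ Y≼ (suc-injective len)
    (⊕-cancelˡ x (trans eq (cong (_⊕ vsum Y) (sym x≡y)))))
  where
  open ≡-Reasoning
  x≡y : x ≡ y
  x≡y = begin
    x                                             ≡⟨ chain-head x≼X ⟨
    Vec.map (_/ suc (length X)) (vsum (x ∷ X))    ≡⟨ cong₂ (λ n → Vec.map (_/ suc n)) (suc-injective len) eq ⟩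
    Vec.map (_/ suc (length Y)) (vsum (y ∷ Y))    ≡⟨ chain-head y≼Y ⟩
    y                                             ∎

window-zero : ∀ {f} a l → (∀ {t} → t < l + a → f t ≡ 0) → window f a l ≡ 0
window-zero a zero    _   = refl
window-zero a (suc l) eq0 = cong₂ _+_ (eq0 (s≤s (m≤n+m a l)))
  (window-zero (suc a) l (λ {t} t< → eq0 (subst (t <_) (+-suc l a) t<)))

-- Hermite's identity. Moving the window one step to the right drops `b / n` and gains
-- `(n + b) / n`, which is one more.
hermite-identity : ∀ n .{{_ : NonZero n}} b → window (_/ n) b n ≡ b
hermite-identity n zero    = window-zero 0 n (λ t<n+0 → m<n⇒m/n≡0 (subst (_ <_) (+-identityʳ n) t<n+0))
hermite-identity n (suc b) = +-cancelˡ-≡ (b / n) _ _ (begin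
  b / n + window (_/ n) (suc b) n          ≡⟨ cong (window (_/ n) b) (+-comm 1 n) ⟩
  window (_/ n) b (n + 1)                  ≡⟨ window-++ (_/ n) b n 1 ⟩
  window (_/ n) b n + ((n + b) / n + 0)    ≡⟨ cong₂ _+_ (hermite-identity n b) (+-identityʳ _) ⟩
  b + (n + b) / n                          ≡⟨ cong (b +_) (trans (+-distrib-/-∣ˡ b ∣-refl) (cong (_+ b / n) (n/n≡1 n))) ⟩
  b + suc (b / n)                          ≡⟨ +-comm b _ ⟩
  suc (b / n) + b                          ≡⟨ +-suc (b / n) b ⟨
  b / n + suc b                            ∎)
  where
  open ≡-Reasoning

sum-applyUpTo : ∀ {f h} a l → (∀ t → h t ≡ f (t + a)) → sum (applyUpTo h l) ≡ window f a l
sum-applyUpTo         a zero    eq = refl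
sum-applyUpTo {f} a (suc l) eq =
  cong₂ _+_ (eq 0) (sum-applyUpTo (suc a) l (λ t → trans (eq (suc t)) (cong f (sym (+-suc t a)))))

vsum-map : ∀ (h : A → ℕ → ℕ) (a : Vec ℕ g) ts →
           vsum (map (λ t → Vec.map (h t) a) ts) ≡ Vec.map (λ b → sum (map (λ t → h t b) ts)) a
vsum-map h []      []       = refl
vsum-map h (b ∷ a) []       = cong (0 ∷_) (vsum-map h a [])
vsum-map h a       (t ∷ ts) = trans (cong (Vec.map (h t) a ⊕_) (vsum-map h a ts)) (zip a)
  where
  zip : ∀ {g} (a : Vec ℕ g) → Vec.map (h t) a ⊕ Vec.map (λ b → sum (map (λ t → h t b) ts)) a ≡
        Vec.map (λ b → h t b + sum (map (λ t → h t b) ts)) a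
  zip []      = refl
  zip (b ∷ a) = cong (_ ∷_) (zip a)

module _ (n : ℕ) .{{_ : NonZero n}} where

  -- For offsets `t < n`, the members of the chain of `n` vectors with sum `a`.
  rounding : Vec ℕ g → ℕ → Vec ℕ g
  rounding a t = Vec.map (λ b → (b + t) / n) a

  vsum-roundings : (a : Vec ℕ g) → vsum (map (rounding a) (upTo n)) ≡ a
  vsum-roundings a = begin
    vsum (map (rounding a) (upTo n))                               ≡⟨ vsum-map (λ t b → (b + t) / n) a (upTo n) ⟩
    Vec.map (λ b → sum (map (λ t → (b + t) / n) (upTo n))) a        ≡⟨ Vec.map-cong hermite a ⟩
    Vec.map (λ b → b) a                                            ≡⟨ Vec.map-id a ⟩
    a                                                              ∎
    where
    open ≡-Reasoning
    hermite : ∀ b → sum (map (λ t → (b + t) / n) (upTo n)) ≡ b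
    hermite b = begin
      sum (map (λ t → (b + t) / n) (upTo n))     ≡⟨ cong sum (map-applyUpTo (λ t → t) (λ t → (b + t) / n) n) ⟩
      sum (applyUpTo (λ t → (b + t) / n) n)      ≡⟨ sum-applyUpTo b n (λ t → cong (_/ n) (+-comm b t)) ⟩
      window (_/ n) b n                          ≡⟨ hermite-identity n b ⟩
      b                                          ∎

  -- The offsets differ by at most `n`, so the quotients differ by at most one.
  rounding-≼ : (a : Vec ℕ g) → ∀ {s t} → s ≤ t → t ≤ n → rounding a s ≼ rounding a t
  rounding-≼ []      s≤t t≤n = []
  rounding-≼ (b ∷ a) {s} {t} s≤t t≤n = consecutive lo hi ∷ rounding-≼ a s≤t t≤n
    where
    lo : (b + s) / n ≤ (b + t) / n
    lo = /-monoˡ-≤ n (+-monoʳ-≤ b s≤t)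
    hi : (b + t) / n ≤ suc ((b + s) / n)
    hi = begin
      (b + t) / n           ≤⟨ /-monoˡ-≤ n (+-monoʳ-≤ b (≤-trans t≤n (m≤n+m n s))) ⟩
      (b + (s + n)) / n     ≡⟨ cong (_/ n) (trans (sym (+-assoc b s n)) (+-comm (b + s) n)) ⟩
      (n + (b + s)) / n     ≡⟨ +-distrib-/-∣ˡ (b + s) ∣-refl ⟩
      n / n + (b + s) / n   ≡⟨ cong (_+ (b + s) / n) (n/n≡1 n) ⟩
      suc ((b + s) / n)     ∎
      where
      open ≤-Reasoning
    consecutive : ∀ {p q} → p ≤ q → q ≤ suc p → q ≡ p ⊎ q ≡ suc p
    consecutive p≤q q≤1+p with m≤n⇒m<n∨m≡n p≤q
    ... | inj₁ p<q = inj₂ (≤-antisym q≤1+p p<q)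
    ... | inj₂ p≡q = inj₁ (sym p≡q)

  roundings-chain : (a : Vec ℕ g) → AllPairs _≼_ (map (rounding a) (upTo n))
  roundings-chain a = AllPairs.map⁺
    (AllPairs.applyUpTo⁺₁ _ n (λ s<t t<n → rounding-≼ a (<⇒≤ s<t) (<⇒≤ t<n)))

∈-support-⊕⁻ : ∀ (u w : Vec ℕ g) {i} → i Subset.∈ support (u ⊕ w) → i Subset.∈ support u ⊎ i Subset.∈ support w
∈-support-⊕⁻ (zero ∷ u)  (suc b ∷ w) {Fin.zero}  _          = inj₂ here
∈-support-⊕⁻ (suc a ∷ u) (b ∷ w) {Fin.zero}  _          = inj₁ here
∈-support-⊕⁻ (a ∷ u)     (b ∷ w) {Fin.suc i} (there i∈) with ∈-support-⊕⁻ u w i∈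
... | inj₁ i∈u = inj₁ (there i∈u)
... | inj₂ i∈w = inj₂ (there i∈w)

∈-support-⊕⁺ˡ : ∀ (u w : Vec ℕ g) {i} → i Subset.∈ support u → i Subset.∈ support (u ⊕ w)
∈-support-⊕⁺ˡ (suc a ∷ u) (b ∷ w) {Fin.zero}  here       = here
∈-support-⊕⁺ˡ (a ∷ u)     (b ∷ w) {Fin.suc i} (there i∈) = there (∈-support-⊕⁺ˡ u w i∈)

∈-support-⊕⁺ʳ : ∀ (u w : Vec ℕ g) {i} → i Subset.∈ support w → i Subset.∈ support (u ⊕ w)
∈-support-⊕⁺ʳ (zero ∷ u)  (suc b ∷ w) {Fin.zero}  here       = here
∈-support-⊕⁺ʳ (suc a ∷ u) (b ∷ w)     {Fin.zero}  _          = here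
∈-support-⊕⁺ʳ (a ∷ u)     (b ∷ w)     {Fin.suc i} (there i∈) = there (∈-support-⊕⁺ʳ u w i∈)

∉-support-0 : ∀ {g i} → ¬ (i Subset.∈ support (Vec.replicate g 0))
∉-support-0 {suc g} (there i∈) = ∉-support-0 i∈

∈-support-vsum⁺ : ∀ {z : Vec ℕ g} {X i} → z ∈ X → i Subset.∈ support z → i Subset.∈ support (vsum X)
∈-support-vsum⁺ {X = z ∷ X} (here refl) i∈ = ∈-support-⊕⁺ˡ z (vsum X) i∈
∈-support-vsum⁺ {X = y ∷ X} (there z∈)  i∈ = ∈-support-⊕⁺ʳ y (vsum X) (∈-support-vsum⁺ z∈ i∈)

∈-support-vsum⁻ : ∀ (X : List (Vec ℕ g)) {i} → i Subset.∈ support (vsum X) →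
                  ∃ λ z → z ∈ X × i Subset.∈ support z
∈-support-vsum⁻ []      i∈ = ⊥-elim (∉-support-0 i∈)
∈-support-vsum⁻ (z ∷ X) i∈ with ∈-support-⊕⁻ z (vsum X) i∈
... | inj₁ i∈z = z , here refl , i∈z
... | inj₂ i∈X with ∈-support-vsum⁻ X i∈X
...   | y , y∈X , i∈y = y , there y∈X , i∈y

support-mono : ∀ {h k : ℕ → ℕ} → (∀ b → 0 < h b → 0 < k b) → (a : Vec ℕ g) →
               support (Vec.map h a) Subset.⊆ support (Vec.map k a)
support-mono         h⇒k []      ()
support-mono {h = h} {k} h⇒k (b ∷ a) {Fin.zero}  here∈ with h b | k b | h⇒k b
... | suc _ | suc _ | _ = here
... | suc _ | zero  | pos with () ← pos z<s
support-mono h⇒k (b ∷ a) {Fin.suc i} (there i∈) = there (support-mono h⇒k a i∈)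

≼-refl : {x : Vec ℕ g} → x ≼ x
≼-refl = Pointwise.refl (inj₁ refl)

embedded-chain-sum-injective : {e : A → Vec ℕ g} → Injective _≡_ _≡_ e → ∀ {X Y} →
  AllPairs (_≼_ on e) X → AllPairs (_≼_ on e) Y → length X ≡ length Y →
  vsum (map e X) ≡ vsum (map e Y) → X ≡ Y
embedded-chain-sum-injective {e = e} e-inj {X} {Y} X≼ Y≼ len eq = map-injective e-inj
  (chain-sum-injective (AllPairs.map⁺ X≼) (AllPairs.map⁺ Y≼)
    (trans (length-map e X) (trans len (sym (length-map e Y)))) eq)

-- Edgewise subdivision

map-+-cancel : ∀ a {u w : Vec ℕ g} → Vec.map (a +_) u ≡ Vec.map (a +_) w → u ≡ w
map-+-cancel a {[]}    {[]}    _  = refl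
map-+-cancel a {b ∷ u} {c ∷ w} eq =
  cong₂ _∷_ (+-cancelˡ-≡ a b c (Vec.∷-injectiveˡ eq)) (map-+-cancel a (Vec.∷-injectiveʳ eq))

ι-injective : Injective _≡_ _≡_ (ι {g})
ι-injective {x = []}    {[]}    _  = refl
ι-injective {x = a ∷ u} {b ∷ w} eq with refl ← Vec.∷-injectiveˡ eq =
  cong (a ∷_) (ι-injective (map-+-cancel a (Vec.∷-injectiveʳ eq)))

-- Partial sums first differ where the vectors do, and in the same direction.
ι-lex : {u w : Vec ℕ g} → Lex _<_ u w → ¬ (ι w ≼ ι u)
ι-lex (this a<b) (inj₁ refl ∷ _) = <-irrefl refl a<b
ι-lex (this a<b) (inj₂ refl ∷ _) = <⇒≱ a<b (n≤1+n _)
ι-lex (next {a = a} u<w) (_ ∷ w≼u) = ι-lex u<w (cancel w≼u)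
  where
  cancel : ∀ {g} {x y : Vec ℕ g} → Vec.map (a +_) x ≼ Vec.map (a +_) y → x ≼ y
  cancel {x = []}    {[]}    []       = []
  cancel {x = b ∷ x} {c ∷ y} (p ∷ ps) =
    Sum.map (+-cancelˡ-≡ a c b) (λ eq → +-cancelˡ-≡ a c (suc b) (trans eq (sym (+-suc a b)))) p ∷ cancel ps

ι-⊕ : (u w : Vec ℕ g) → ι (u ⊕ w) ≡ ι u ⊕ ι w
ι-⊕ []      []      = refl
ι-⊕ (a ∷ u) (b ∷ w) = cong (a + b ∷_)
  (trans (cong (Vec.map (a + b +_)) (ι-⊕ u w)) (distrib (ι u) (ι w)))
  where
  distrib : ∀ {g} (x y : Vec ℕ g) → Vec.map (a + b +_) (x ⊕ y) ≡ Vec.map (a +_) x ⊕ Vec.map (b +_) y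
  distrib []      []      = refl
  distrib (c ∷ x) (d ∷ y) = cong₂ _∷_ (interchange a b c d) (distrib x y)

ι-0 : ∀ g → ι (Vec.replicate g 0) ≡ Vec.replicate g 0
ι-0 zero    = refl
ι-0 (suc g) = cong (0 ∷_) (trans (Vec.map-id (ι (Vec.replicate g 0))) (ι-0 g))

ι-vsum : (X : List (Vec ℕ g)) → ι (vsum X) ≡ vsum (map ι X)
ι-vsum {g} []      = ι-0 g
ι-vsum     (u ∷ X) = trans (ι-⊕ u (vsum X)) (cong (ι u ⊕_) (ι-vsum X))

sum-⊕ : (u w : Vec ℕ g) → Vec.sum (u ⊕ w) ≡ Vec.sum u + Vec.sum w
sum-⊕ []      []      = refl
sum-⊕ (a ∷ u) (b ∷ w) = trans (cong (a + b +_) (sum-⊕ u w)) (interchange a b (Vec.sum u) (Vec.sum w))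

sum-0 : ∀ g → Vec.sum (Vec.replicate g 0) ≡ 0
sum-0 zero    = refl
sum-0 (suc g) = sum-0 g

sum≡0⇒0 : (u : Vec ℕ g) → Vec.sum u ≡ 0 → Vec.replicate g 0 ≡ u
sum≡0⇒0 []         _  = refl
sum≡0⇒0 (zero ∷ u) eq = cong (0 ∷_) (sum≡0⇒0 u eq)

sum-vsum : ∀ {r} {X : List (Vec ℕ g)} → All (λ u → Vec.sum u ≡ r) X → Vec.sum (vsum X) ≡ r * length X
sum-vsum {g} {r} []        = trans (sum-0 g) (sym (*-zeroʳ r))
sum-vsum {r = r} {u ∷ X} (eq ∷ eqs) =
  trans (sum-⊕ u (vsum X)) (trans (cong₂ _+_ eq (sum-vsum eqs)) (sym (*-suc r (length X))))

lookup≤sum : (u : Vec ℕ g) → ∀ i → Vec.lookup u i ≤ Vec.sum u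
lookup≤sum (a ∷ u) Fin.zero    = m≤m+n a (Vec.sum u)
lookup≤sum (a ∷ u) (Fin.suc i) = ≤-trans (lookup≤sum u i) (m≤n+m (Vec.sum u) a)

module _ (n : ℕ) .{{_ : NonZero n}} where

  -- The vector u with ι u = rounding n (ι w) t, when p = 0; in general p is
  -- the sum of the entries that precede w.
  slice : ℕ → Vec ℕ g → ℕ → Vec ℕ g
  slice p []      t = []
  slice p (b ∷ w) t = ((p + b + t) / n ∸ (p + t) / n) ∷ slice (p + b) w t

  private
    -- Quotients are monotone, so the truncated subtraction in `slice` is exact.
    slice-head : ∀ p b t → (p + t) / n + ((p + b + t) / n ∸ (p + t) / n) ≡ (p + b + t) / n
    slice-head p b t = m+[n∸m]≡n (/-monoˡ-≤ n (+-monoˡ-≤ t (m≤m+n p b)))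

  ι-slice : ∀ p (w : Vec ℕ g) t →
            Vec.map ((p + t) / n +_) (ι (slice p w t)) ≡ rounding n (Vec.map (p +_) (ι w)) t
  ι-slice p []      t = refl
  ι-slice p (b ∷ w) t = cong₂ _∷_ (slice-head p b t) (begin
    Vec.map (q +_) (Vec.map (δ +_) (ι (slice (p + b) w t)))
      ≡⟨ Vec.map-∘ (q +_) (δ +_) _ ⟨
    Vec.map (λ x → q + (δ + x)) (ι (slice (p + b) w t))
      ≡⟨ Vec.map-cong (λ x → trans (sym (+-assoc q δ x)) (cong (_+ x) (slice-head p b t))) _ ⟩
    Vec.map ((p + b + t) / n +_) (ι (slice (p + b) w t))
      ≡⟨ ι-slice (p + b) w t ⟩
    rounding n (Vec.map (p + b +_) (ι w)) t
      ≡⟨ cong (λ x → rounding n x t) (trans (Vec.map-cong (+-assoc p b) (ι w)) (Vec.map-∘ (p +_) (b +_) (ι w))) ⟩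
    rounding n (Vec.map (p +_) (Vec.map (b +_) (ι w))) t ∎)
    where
    open ≡-Reasoning
    q δ : ℕ
    q = (p + t) / n
    δ = (p + b + t) / n ∸ (p + t) / n

  sum-slice : ∀ p (w : Vec ℕ g) t → (p + t) / n + Vec.sum (slice p w t) ≡ (p + Vec.sum w + t) / n
  sum-slice p []      t = trans (+-identityʳ _) (cong (λ p → (p + t) / n) (sym (+-identityʳ p)))
  sum-slice p (b ∷ w) t = begin
    (p + t) / n + (_ + Vec.sum (slice (p + b) w t))  ≡⟨ +-assoc ((p + t) / n) _ _ ⟨
    _ + Vec.sum (slice (p + b) w t)                  ≡⟨ cong (_+ Vec.sum (slice (p + b) w t)) (slice-head p b t) ⟩
    (p + b + t) / n + Vec.sum (slice (p + b) w t)    ≡⟨ sum-slice (p + b) w t ⟩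
    (p + b + Vec.sum w + t) / n                      ≡⟨ cong (λ s → (s + t) / n) (+-assoc p b (Vec.sum w)) ⟩
    (p + (b + Vec.sum w) + t) / n                    ∎
    where open ≡-Reasoning

-- The `t`-th slice has total `(t + r * n) / n`, which is `r` because `t < n`. Thus a total
-- divisible by `n` makes every slice eligible as a vertex of the subdivision.
edgewise-decomposition : ∀ r n (w : Vec ℕ g) → Vec.sum w ≡ r * n →
  ∃ λ X → length X ≡ n × vsum X ≡ w × AllPairs (_≼_ on ι) X × All (λ u → Vec.sum u ≡ r) X
edgewise-decomposition r zero w eq =
  [] , refl , sum≡0⇒0 w (trans eq (*-zeroʳ r)) , [] , []
edgewise-decomposition {g} r n@(suc _) w eq =
  X , trans (length-map (slice n 0 w) (upTo n)) (length-upTo n) , ι-injective ι-sum ,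
  AllPairs.map⁻ (subst (AllPairs _≼_) (sym map-ι) (roundings-chain n (ι w))) ,
  All.map⁺ (All.tabulate (λ t∈ → sum≡r (∈-upTo⁻ t∈)))
  where
  open ≡-Reasoning
  X : List (Vec ℕ g)
  X = map (slice n 0 w) (upTo n)
  ι-at : ∀ {t} → t < n → ι (slice n 0 w t) ≡ rounding n (ι w) t
  ι-at {t} t<n = begin
    ι (slice n 0 w t)                         ≡⟨ Vec.map-id _ ⟨
    Vec.map (0 +_) (ι (slice n 0 w t))        ≡⟨ cong (λ q → Vec.map (q +_) (ι (slice n 0 w t))) (m<n⇒m/n≡0 t<n) ⟨
    Vec.map (t / n +_) (ι (slice n 0 w t))    ≡⟨ ι-slice n 0 w t ⟩
    rounding n (Vec.map (0 +_) (ι w)) t       ≡⟨ cong (λ x → rounding n x t) (Vec.map-id (ι w)) ⟩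
    rounding n (ι w) t                        ∎
  map-ι : map ι X ≡ map (rounding n (ι w)) (upTo n)
  map-ι = trans (sym (map-∘ (upTo n))) (map-cong-local (All.tabulate (λ t∈ → ι-at (∈-upTo⁻ t∈))))
  ι-sum : ι (vsum X) ≡ ι w
  ι-sum = trans (ι-vsum X) (trans (cong vsum map-ι) (vsum-roundings n (ι w)))
  sum≡r : ∀ {t} → t < n → Vec.sum (slice n 0 w t) ≡ r
  sum≡r {t} t<n = begin
    Vec.sum (slice n 0 w t)              ≡⟨ cong (_+ Vec.sum (slice n 0 w t)) (m<n⇒m/n≡0 t<n) ⟨
    t / n + Vec.sum (slice n 0 w t)      ≡⟨ sum-slice n 0 w t ⟩
    (Vec.sum w + t) / n                  ≡⟨ cong (λ s → s / n) (trans (cong (_+ t) eq) (+-comm (r * n) t)) ⟩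
    (t + r * n) / n                      ≡⟨ [j+t*n]/n≡t r t<n ⟩
    r                                    ∎

-- The bijection sends a multiset to its sum. Entries are non-negative, so the support of the sum is
-- the union of the supports, and the face conditions on the two sides agree.
multisets-esd : ∀ r Γ n → multisets (esd r Γ) n ≡ multisets Γ (r * n)
multisets-esd r Γ n = length-≡-by-bijection
  (AllPairs.filter⁺ _ (weakCompositions-unique (length L) n))
  (AllPairs.filter⁺ _ (weakCompositions-unique (ground Γ) (r * n)))
  (vsum ∘ expand L) into injective onto
  where
  L : List (Vec ℕ (ground Γ))
  L = esdVertices r Γ
  ext : LinearExtension (_≼_ on ι) L
  ext = AllPairs.filter⁺ _ (AllPairs.map ι-lex (vectors-lex (upTo-< (suc r)) (ground Γ)))
  L! : Unique L
  L! = linearExtension-unique {R = _≼_ on ι} ≼-refl ext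
  P? : Decidable (λ u → Face (esd r Γ) (support u))
  P? u = face? (esd r Γ) (support u)
  Q? : Decidable (λ w → Face Γ (support w))
  Q? w = face? Γ (support w)
  V : List (Vec ℕ (length L))
  V = weakCompositions (length L) n
  inL : ∀ {z} → z ∈ L → Vec.sum z ≡ r × Face Γ (support z)
  inL z∈ = proj₂ (∈-filter⁻ _ {xs = vectors (upTo (suc r)) (ground Γ)} z∈)
  length≡n : ∀ {u} → u ∈ filter P? V → length (expand L u) ≡ n
  length≡n {u} u∈ = trans (length-expand L u)
    (∈-weakCompositions⁻ (length L) n (proj₁ (∈-filter⁻ P? u∈)))
  chain : ∀ {u} → u ∈ filter P? V → AllPairs (_≼_ on ι) (expand L u)
  chain {u} u∈ with ∈-filter⁻ P? {xs = V} u∈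
  ... | _ , _ , close = expand-chain {R = _≼_ on ι} ≼-refl ext u (λ i j i∈ j∈ → Sum.swap (close i j i∈ j∈))
  into : ∀ {u} → u ∈ filter P? V → vsum (expand L u) ∈ filter Q? (weakCompositions (ground Γ) (r * n))
  into {u} u∈ with ∈-filter⁻ P? {xs = V} u∈
  ... | _ , face , _ = ∈-filter⁺ Q?
    (subst (λ s → vsum (expand L u) ∈ weakCompositions (ground Γ) s)
      (trans (sum-vsum (All.tabulate (λ z∈ → proj₁ (inL (expand-⊆ L u z∈))))) (cong (r *_) (length≡n u∈)))
      (∈-weakCompositions⁺ (vsum (expand L u))))
    (closed Γ sub face)
    where
    sub : support (vsum (expand L u)) Subset.⊆ supportUnion L (support u)
    sub v∈ with ∈-support-vsum⁻ (expand L u) v∈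
    ... | z , z∈ , v∈z with ∈-expand⁻ L u z∈
    ...   | i , i∈ , refl = ∈-supportUnion⁺ L (i , i∈ , v∈z)
  injective : ∀ {u w} → u ∈ filter P? V → w ∈ filter P? V → vsum (expand L u) ≡ vsum (expand L w) → u ≡ w
  injective {u} {w} u∈ w∈ eq = expand-injective L! u w
    (embedded-chain-sum-injective ι-injective (chain u∈) (chain w∈)
      (trans (length≡n u∈) (sym (length≡n w∈)))
      (trans (sym (ι-vsum (expand L u))) (trans (cong ι eq) (ι-vsum (expand L w)))))
  onto : ∀ {w} → w ∈ filter Q? (weakCompositions (ground Γ) (r * n)) →
         ∃ λ u → u ∈ filter P? V × vsum (expand L u) ≡ w
  onto {w} w∈ with ∈-filter⁻ Q? {xs = weakCompositions (ground Γ) (r * n)} w∈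
  ... | w∈W , face with edgewise-decomposition r n w (∈-weakCompositions⁻ (ground Γ) (r * n) w∈W)
  ...   | X , length≡ , sum≡ , X≼ , sums
    with expand-surjective ext (All.tabulate (λ {z} z∈ → ∈L z∈ (All.lookup sums z∈))) X≼
    where
    ∈L : ∀ {z} → z ∈ X → Vec.sum z ≡ r → z ∈ L
    ∈L {z} z∈ sum≡r = ∈-filter⁺ _
      (∈-vectors⁺ (λ i → ∈-upTo⁺ (s≤s (≤-trans (lookup≤sum z i) (≤-reflexive sum≡r)))))
      (sum≡r , closed Γ (λ i∈ → subst (λ w → _ Subset.∈ support w) sum≡ (∈-support-vsum⁺ z∈ i∈)) face)
  ...   | u , refl = u , ∈-filter⁺ P? u∈V (closed Γ sub face , close) , sum≡
    where
    u∈V : u ∈ V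
    u∈V = subst (λ s → u ∈ weakCompositions (length L) s) (trans (sym (length-expand L u)) length≡) (∈-weakCompositions⁺ u)
    sub : supportUnion L (support u) Subset.⊆ support w
    sub v∈ with ∈-supportUnion⁻ L {support u} v∈
    ... | i , i∈ , v∈z = subst (λ w → _ Subset.∈ support w) sum≡ (∈-support-vsum⁺ (∈-expand⁺ L u i∈) v∈z)
    close : ∀ i j → i Subset.∈ support u → j Subset.∈ support u → Close (List.lookup L i) (List.lookup L j)
    close i j i∈ j∈ = Sum.swap (chain-comparable {R = _≼_ on ι} ≼-refl X≼ (∈-expand⁺ L u i∈) (∈-expand⁺ L u j∈))

-- Barycentric subdivision

χ : Subset g → Vec ℕ g
χ = Vec.map (λ b → if b then 1 else 0)

χ-injective : Injective _≡_ _≡_ (χ {g})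
χ-injective {x = []}        {[]}        _  = refl
χ-injective {x = true ∷ S}  {true ∷ T}  eq = cong (true ∷_) (χ-injective (Vec.∷-injectiveʳ eq))
χ-injective {x = false ∷ S} {false ∷ T} eq = cong (false ∷_) (χ-injective (Vec.∷-injectiveʳ eq))

χ-mono : {S T : Subset g} → S Subset.⊆ T → χ S ≼ χ T
χ-mono {S = []}        {[]}        _   = []
χ-mono {S = false ∷ S} {false ∷ T} S⊆T = inj₁ refl ∷ χ-mono (drop-∷-⊆ S⊆T)
χ-mono {S = false ∷ S} {true ∷ T}  S⊆T = inj₂ refl ∷ χ-mono (drop-∷-⊆ S⊆T)
χ-mono {S = true ∷ S}  {true ∷ T}  S⊆T = inj₁ refl ∷ χ-mono (drop-∷-⊆ S⊆T)
χ-mono {S = true ∷ S}  {false ∷ T} S⊆T with () ← S⊆T here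

χ-cancel : {S T : Subset g} → χ S ≼ χ T → S Subset.⊆ T
χ-cancel {S = true ∷ S} {true ∷ T}  (_ ∷ _)      here       = here
χ-cancel {S = true ∷ S} {false ∷ T} (inj₁ () ∷ _) here
χ-cancel {S = true ∷ S} {false ∷ T} (inj₂ () ∷ _) here
χ-cancel {S = _ ∷ S}    {_ ∷ T}     (_ ∷ S≼T)    (there i∈) = there (χ-cancel S≼T i∈)

χ-lex : {S T : Subset g} → Lex Bool._<_ S T → ¬ (χ T ≼ χ S)
χ-lex (this f<t) (inj₁ () ∷ _)
χ-lex (this f<t) (inj₂ () ∷ _)
χ-lex (next S<T) (_ ∷ T≼S) = χ-lex S<T T≼S

support-χ : (S : Subset g) → support (χ S) ≡ S
support-χ []          = refl
support-χ (true ∷ S)  = cong (true ∷_) (support-χ S)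
support-χ (false ∷ S) = cong (false ∷_) (support-χ S)

χ-support : (y : Vec ℕ g) → (∀ i → Vec.lookup y i ≤ 1) → χ (support y) ≡ y
χ-support []                _  = refl
χ-support (zero ∷ y)        ≤1 = cong (0 ∷_) (χ-support y (≤1 ∘ Fin.suc))
χ-support (suc zero ∷ y)    ≤1 = cong (1 ∷_) (χ-support y (≤1 ∘ Fin.suc))
χ-support (suc (suc a) ∷ y) ≤1 with s≤s () ← ≤1 Fin.zero

lookup-χ≤1 : (S : Subset g) → ∀ i → Vec.lookup (χ S) i ≤ 1
lookup-χ≤1 (true ∷ S)  Fin.zero    = ≤-refl
lookup-χ≤1 (false ∷ S) Fin.zero    = z≤n
lookup-χ≤1 (_ ∷ S)     (Fin.suc i) = lookup-χ≤1 S i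

lookup-χ-∈ : {S : Subset g} → ∀ {i} → i Subset.∈ S → Vec.lookup (χ S) i ≡ 1
lookup-χ-∈ here       = refl
lookup-χ-∈ (there i∈) = lookup-χ-∈ i∈

lookup-vsum-χ≤ : (X : List (Subset g)) → ∀ i → Vec.lookup (vsum (map χ X)) i ≤ length X
lookup-vsum-χ≤ []      i = ≤-reflexive (Vec.lookup-replicate i 0)
lookup-vsum-χ≤ (S ∷ X) i = ≤-trans (≤-reflexive (Vec.lookup-zipWith _+_ i (χ S) (vsum (map χ X))))
  (+-mono-≤ (lookup-χ≤1 S i) (lookup-vsum-χ≤ X i))

lookup-vsum-χ≡ : ∀ {X : List (Subset g)} {i} → All (i Subset.∈_) X → Vec.lookup (vsum (map χ X)) i ≡ length X
lookup-vsum-χ≡ {i = i} []           = Vec.lookup-replicate i 0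
lookup-vsum-χ≡ {X = S ∷ X} {i} (i∈ ∷ is) = trans (Vec.lookup-zipWith _+_ i (χ S) (vsum (map χ X)))
  (cong₂ _+_ (lookup-χ-∈ i∈) (lookup-vsum-χ≡ is))

-- All pairs being related, the last member is the largest; for faces it contains the whole union,
-- which is how the support of a sum is seen to be a face.
chain-top : ∀ {S : Subset g} {X} → AllPairs (_≼_ on χ) (S ∷ X) → ∃ λ T → T ∈ S ∷ X × All (λ U → χ U ≼ χ T) (S ∷ X)
chain-top {S = S} {[]}    _         = S , here refl , ≼-refl ∷ []
chain-top {X = _ ∷ _}     (S≼ ∷ X≼) with chain-top X≼
... | T , T∈ , ≼T = T , there T∈ , All.lookup S≼ T∈ ∷ ≼T

-- v is the multichain whose i-th largest member is {x : v x ≥ i}, for 1 ≤ i ≤ m.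
multichains : SimplicialComplex → ℕ → ℕ
multichains Δ m = count (face? Δ ∘ support) (vectors (upTo (suc m)) (ground Δ))

count-split : {P Q : A → Set} (P? : Decidable P) (Q? : Decidable Q) → ∀ xs →
  count P? xs ≡ count (λ x → P? x ×-dec ¬? (Q? x)) xs + count (λ x → P? x ×-dec Q? x) xs
count-split P? Q? []       = refl
count-split P? Q? (x ∷ xs) with does (P? x) | does (Q? x)
... | false | _     = count-split P? Q? xs
... | true  | false = cong suc (count-split P? Q? xs)
... | true  | true  = trans (cong suc (count-split P? Q? xs)) (sym (+-suc _ _))

count-[] : {P : A → Set} (P? : Decidable P) → ∀ {x} → P x → count P? (x ∷ []) ≡ 1
count-[] P? {x} Px with P? x
... | yes _  = refl
... | no ¬Px = ⊥-elim (¬Px Px)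

support-0 : ∀ g → support (Vec.replicate g 0) ≡ Subset.⊥
support-0 zero    = refl
support-0 (suc g) = cong (false ∷_) (support-0 g)

weakCompositions-0 : ∀ g → weakCompositions g 0 ≡ Vec.replicate g 0 ∷ []
weakCompositions-0 zero    = refl
weakCompositions-0 (suc g) = cong (map (0 ∷_)) (weakCompositions-0 g)

vectors-0 : ∀ g → vectors (upTo 1) g ≡ Vec.replicate g 0 ∷ []
vectors-0 zero    = refl
vectors-0 (suc g) = cong (cartesianProductWith _∷_ (upTo 1)) (vectors-0 g)

multisets-0 : ∀ Δ → multisets Δ 0 ≡ 1
multisets-0 Δ = trans (cong (count (face? Δ ∘ support)) (weakCompositions-0 (ground Δ)))
  (count-[] (face? Δ ∘ support) (subst (Face Δ) (sym (support-0 (ground Δ))) (⊥-face Δ)))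

multichains-0 : ∀ Δ → multichains Δ 0 ≡ 1
multichains-0 Δ = trans (cong (count (face? Δ ∘ support)) (vectors-0 (ground Δ)))
  (count-[] (face? Δ ∘ support) (subst (Face Δ) (sym (support-0 (ground Δ))) (⊥-face Δ)))

module _ (Δ : SimplicialComplex) (k : ℕ) where

  private
    m : ℕ
    m = suc k
    G : ℕ
    G = ground Δ
    P? : Decidable (λ v → Face Δ (support v))
    P? v = face? Δ (support v)
    Q? : Decidable (λ (v : Vec ℕ G) → ∃ λ i → Vec.lookup v i ≡ m)
    Q? v = any? (λ i → Vec.lookup v i ≟ m)
    V : List (Vec ℕ G)
    V = vectors (upTo (suc m)) G

  count-below : count (λ v → P? v ×-dec ¬? (Q? v)) V ≡ multichains Δ k
  count-below = length-≡-by-bijection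
    (AllPairs.filter⁺ _ (vectors-unique (suc m) G)) (AllPairs.filter⁺ P? (vectors-unique m G))
    (λ v → v) into (λ _ _ eq → eq) onto
    where
    R? : Decidable _
    R? v = P? v ×-dec ¬? (Q? v)
    into : ∀ {v} → v ∈ filter R? V → v ∈ filter P? (vectors (upTo m) G)
    into v∈ with ∈-filter⁻ R? {xs = V} v∈
    ... | v∈V , face , ¬Qv = ∈-filter⁺ P?
      (∈-vectors⁺ (λ i → ∈-upTo⁺ (≤∧≢⇒< (s≤s⁻¹ (∈-upTo⁻ (∈-vectors⁻ v∈V i))) (λ eq → ¬Qv (i , eq))))) face
    onto : ∀ {v} → v ∈ filter P? (vectors (upTo m) G) → ∃ λ u → u ∈ filter R? V × u ≡ v
    onto {v} v∈ with ∈-filter⁻ P? {xs = vectors (upTo m) G} v∈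
    ... | v∈V , face = v , ∈-filter⁺ R?
      (∈-vectors⁺ (λ i → ∈-upTo⁺ (m≤n⇒m≤1+n (∈-upTo⁻ (∈-vectors⁻ v∈V i)))))
      (face , λ { (i , eq) → <⇒≢ (∈-upTo⁻ (∈-vectors⁻ v∈V i)) eq }) , refl

  -- A vector attains `m` exactly when the smallest of the `m` members of its multichain is
  -- nonempty, that is, when all members are vertices of `sd Δ`.
  count-attained : multisets (sd Δ) m ≡ count (λ v → P? v ×-dec Q? v) V
  count-attained = length-≡-by-bijection
    (AllPairs.filter⁺ C? (weakCompositions-unique (length L) m))
    (AllPairs.filter⁺ R? (vectors-unique (suc m) G))
    (λ u → vsum (map χ (expand L u))) into injective onto
    where
    L : List (Subset G)
    L = nonemptyFaces Δ
    ext : LinearExtension (_≼_ on χ) L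
    ext = AllPairs.filter⁺ _ (AllPairs.map χ-lex (vectors-lex ((f<t ∷ []) ∷ [] ∷ []) G))
    R? : Decidable _
    R? v = P? v ×-dec Q? v
    C? : Decidable (λ u → Face (sd Δ) (support u))
    C? u = face? (sd Δ) (support u)
    U : List (Vec ℕ (length L))
    U = weakCompositions (length L) m
    inL : ∀ {S} → S ∈ L → Face Δ S × Subset.Nonempty S
    inL S∈ = proj₂ (∈-filter⁻ (λ S → face? Δ S ×-dec nonempty? S) {xs = subsets G} S∈)
    length≡m : ∀ {u} → u ∈ filter C? U → length (expand L u) ≡ m
    length≡m {u} u∈ = trans (length-expand L u)
      (∈-weakCompositions⁻ (length L) m (proj₁ (∈-filter⁻ C? u∈)))
    chain : ∀ {u} → u ∈ filter C? U → AllPairs (_≼_ on χ) (expand L u)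
    chain {u} u∈ with ∈-filter⁻ C? {xs = U} u∈
    ... | _ , face = expand-chain {R = _≼_ on χ} ≼-refl ext u
      (λ i j i∈ j∈ → Sum.map χ-mono χ-mono (face i j i∈ j∈))
    chain-sum : ∀ {X} → All (_∈ L) X → AllPairs (_≼_ on χ) X → length X ≡ m →
                vsum (map χ X) ∈ filter R? V
    chain-sum {S ∷ X} X∈ X≼@(S≼ ∷ _) len = ∈-filter⁺ R?
      (∈-vectors⁺ (λ i → ∈-upTo⁺ (s≤s (≤-trans (lookup-vsum-χ≤ (S ∷ X) i) (≤-reflexive len)))))
      (bounded (chain-top X≼) , attained (proj₂ (inL (All.head X∈))))
      where
      bounded : ∃ (λ T → T ∈ S ∷ X × All (λ U → χ U ≼ χ T) (S ∷ X)) → Face Δ (support (vsum (map χ (S ∷ X))))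
      bounded (T , T∈ , ≼T) = closed Δ sub (proj₁ (inL (All.lookup X∈ T∈)))
        where
        sub : support (vsum (map χ (S ∷ X))) Subset.⊆ T
        sub i∈ with ∈-support-vsum⁻ (map χ (S ∷ X)) i∈
        ... | z , z∈ , i∈z with ∈-map⁻ χ z∈
        ...   | W , W∈ , refl = χ-cancel (All.lookup ≼T W∈) (subst (_ Subset.∈_) (support-χ W) i∈z)
      -- A vertex of the smallest member `S` lies in all `m` members, so its coordinate in the sum
      -- is exactly `m`.
      attained : Subset.Nonempty S → ∃ λ i → Vec.lookup (vsum (map χ (S ∷ X))) i ≡ m
      attained (i , i∈S) = i , trans (lookup-vsum-χ≡ (i∈S ∷ All.map (λ S≼T → χ-cancel S≼T i∈S) S≼)) len
    into : ∀ {u} → u ∈ filter C? U → vsum (map χ (expand L u)) ∈ filter R? V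
    into {u} u∈ = chain-sum (All.tabulate (expand-⊆ L u)) (chain u∈) (length≡m u∈)
    injective : ∀ {u w} → u ∈ filter C? U → w ∈ filter C? U →
                vsum (map χ (expand L u)) ≡ vsum (map χ (expand L w)) → u ≡ w
    injective {u} {w} u∈ w∈ eq = expand-injective (linearExtension-unique {R = _≼_ on χ} ≼-refl ext) u w
      (embedded-chain-sum-injective χ-injective (chain u∈) (chain w∈)
        (trans (length≡m u∈) (sym (length≡m w∈))) eq)
    decompose : ∀ v → (∀ i → Vec.lookup v i ≤ m) → (∃ λ i → Vec.lookup v i ≡ m) → Face Δ (support v) →
                ∃ λ X → All (_∈ L) X × AllPairs (_≼_ on χ) X × length X ≡ m × vsum (map χ X) ≡ v
    decompose v v≤m (i₀ , v[i₀]≡m) face =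
      X , X∈L , X≼ , trans (length-map level (upTo m)) (length-upTo m) ,
      trans (cong vsum map-χ) (vsum-roundings m v)
      where
      -- For `b ≤ m` and `t < m` the rounding `(b + t) / m` is 0 or 1, and it is 1 exactly when
      -- `b ≥ m ∸ t`: the levels are the upper level sets of `v`, in increasing order.
      level : ℕ → Subset G
      level t = support (rounding m v t)
      X : List (Subset G)
      X = map level (upTo m)
      χ-level : ∀ {t} → t < m → χ (level t) ≡ rounding m v t
      χ-level {t} t<m = χ-support (rounding m v t) (λ i →
        subst (_≤ 1) (sym (Vec.lookup-map i (λ b → (b + t) / m) v))
          (s≤s⁻¹ (m<n*o⇒m/o<n {n = 2} (subst (Vec.lookup v i + t <_) (cong (m +_) (sym (+-identityʳ m)))
            (+-mono-≤-< (v≤m i) t<m)))))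
      map-χ : map χ X ≡ map (rounding m v) (upTo m)
      map-χ = trans (sym (map-∘ (upTo m))) (map-cong-local (All.tabulate (λ t∈ → χ-level (∈-upTo⁻ t∈))))
      X≼ : AllPairs (_≼_ on χ) X
      X≼ = AllPairs.map⁻ (subst (AllPairs _≼_) (sym map-χ) (roundings-chain m v))
      level∈L : ∀ {t} → t < m → level t ∈ L
      level∈L {t} t<m = ∈-filter⁺ (λ S → face? Δ S ×-dec nonempty? S)
        (∈-vectors⁺ (λ i → bool∈ (Vec.lookup (level t) i))) (closed Δ sub face , i₀ , i₀∈)
        where
        bool∈ : ∀ b → b ∈ false ∷ true ∷ []
        bool∈ false = here refl
        bool∈ true  = there (here refl)
        sub : level t Subset.⊆ support v
        sub i∈ = subst (λ w → _ Subset.∈ support w) (Vec.map-id v)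
          (support-mono {h = λ b → (b + t) / m} {k = λ b → b} positive v i∈)
          where
          positive : ∀ b → 0 < (b + t) / m → 0 < b
          positive zero    0<t/m = ⊥-elim (<⇒≢ 0<t/m (sym (m<n⇒m/n≡0 t<m)))
          positive (suc b) _     = z<s
        -- A coordinate equal to `m` gives a positive quotient at every offset, so no level is
        -- empty.
        i₀∈ : i₀ Subset.∈ level t
        i₀∈ = ∈-support⁺ (rounding m v t) i₀ (subst (0 <_) (sym (Vec.lookup-map i₀ (λ b → (b + t) / m) v))
          (m≥n⇒m/n>0 (≤-trans (≤-reflexive (sym v[i₀]≡m)) (m≤m+n _ t))))
          where
          ∈-support⁺ : ∀ {g} (u : Vec ℕ g) i → 0 < Vec.lookup u i → i Subset.∈ support u
          ∈-support⁺ (suc _ ∷ u) Fin.zero    _   = here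
          ∈-support⁺ (_ ∷ u)     (Fin.suc i) pos = there (∈-support⁺ u i pos)
      X∈L : All (_∈ L) X
      X∈L = All.map⁺ (All.tabulate (λ t∈ → level∈L (∈-upTo⁻ t∈)))
    onto : ∀ {v} → v ∈ filter R? V → ∃ λ u → u ∈ filter C? U × vsum (map χ (expand L u)) ≡ v
    onto {v} v∈ with ∈-filter⁻ R? {xs = V} v∈
    ... | v∈V , face , attained
      with decompose v (λ i → s≤s⁻¹ (∈-upTo⁻ (∈-vectors⁻ v∈V i))) attained face
    ...   | X , X∈L , X≼ , length≡ , sum≡ with expand-surjective ext X∈L X≼
    ...     | u , refl = u , ∈-filter⁺ C? u∈U comparable , sum≡
      where
      u∈U : u ∈ U
      u∈U = subst (λ s → u ∈ weakCompositions (length L) s) (trans (sym (length-expand L u)) length≡) (∈-weakCompositions⁺ u)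
      comparable : ∀ i j → i Subset.∈ support u → j Subset.∈ support u → Comparable (List.lookup L i) (List.lookup L j)
      comparable i j i∈ j∈ = Sum.map χ-cancel χ-cancel
        (chain-comparable {R = _≼_ on χ} ≼-refl X≼ (∈-expand⁺ L u i∈) (∈-expand⁺ L u j∈))

-- The split is by whether the smallest member of the multichain is empty. If so, no coordinate
-- attains the maximum, and the vector is already counted for `k`.
multisets-sd : ∀ Δ m → multichains Δ m ≡ shift 1 (multichains Δ) m + multisets (sd Δ) m
multisets-sd Δ zero    = trans (multichains-0 Δ) (sym (multisets-0 (sd Δ)))
multisets-sd Δ (suc k) = trans (count-split (face? Δ ∘ support) (λ v → any? (λ i → Vec.lookup v i ≟ suc k))
  (vectors (upTo (suc (suc k))) (ground Δ)))
  (cong₂ _+_ (count-below Δ k) (sym (count-attained Δ k)))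

-- Test complexes

-- Avoids j S: the first j + 1 elements of the ground set are not all in S.
data Avoids : ∀ {g} → ℕ → Subset g → Set where
  out : ∀ {g j} {S : Subset g} → Avoids j (outside ∷ S)
  present : ∀ {g j} {S : Subset g} → Avoids j S → Avoids (suc j) (inside ∷ S)

avoids? : ∀ j → Decidable (Avoids {g} j)
avoids? j       []            = no λ ()
avoids? j       (outside ∷ S) = yes out
avoids? zero    (inside ∷ S)  = no λ ()
avoids? (suc j) (inside ∷ S)  = map′ present (λ { (present a) → a }) (avoids? j S)

avoids-closed : ∀ {j} {S T : Subset g} → S Subset.⊆ T → Avoids j T → Avoids j S
avoids-closed {S = outside ∷ S} _   _       = out
avoids-closed {S = inside ∷ S}  S⊆T out     with () ← S⊆T here
avoids-closed {S = inside ∷ S}  S⊆T (present a) = present (avoids-closed (drop-∷-⊆ S⊆T) a)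

avoids-card : ∀ {j} {S : Subset g} → Avoids j S → ∣ S ∣ < g
avoids-card {S = _ ∷ S} out     = s≤s (∣p∣≤n S)
avoids-card             (present a) = s≤s (avoids-card a)

-- The join of the boundary of a simplex on j + 1 vertices with a simplex on
-- d - j vertices; its h-polynomial is 1 + x + ⋯ + xʲ.
boundaryJoin : (d j : ℕ) → SimplicialComplex
boundaryJoin d j = record
  { ground = suc d
  ; Face   = Avoids j
  ; face?  = avoids? j
  ; ⊥-face = out
  ; closed = avoids-closed
  }

boundaryJoin-dim : ∀ d j → HasDim+1 (boundaryJoin d j) d
boundaryJoin-dim d j = (outside ∷ Subset.⊤ , out , ∣⊤∣≡n d) , λ _ a → s≤s⁻¹ (avoids-card a)

window-0-suc : ∀ f l → window f 0 (suc l) ≡ window f 0 l + f l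
window-0-suc f l = trans (cong (window f 0) (+-comm 1 l)) (trans (window-++ f 0 l 1)
  (cong (window f 0 l +_) (trans (+-identityʳ _) (cong f (+-identityʳ l)))))

window-∘suc : ∀ f a l → window f (suc a) l ≡ window (f ∘ suc) a l
window-∘suc f a zero    = refl
window-∘suc f a (suc l) = cong (f (suc a) +_) (window-∘suc f (suc a) l)

window-* : ∀ c f a l → window (λ t → c * f t) a l ≡ c * window f a l
window-* c f a zero    = sym (*-zeroʳ c)
window-* c f a (suc l) = trans (cong (c * f a +_) (window-* c f (suc a) l)) (sym (*-distribˡ-+ c (f a) _))

window-+ : ∀ f h a l → window (λ t → f t + h t) a l ≡ window f a l + window h a l
window-+ f h a zero    = refl
window-+ f h a (suc l) = trans (cong (f a + h a +_) (window-+ f h (suc a) l))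
  (interchange (f a) (h a) (window f (suc a) l) (window h (suc a) l))

window-cong-≤ : ∀ {f h} a l → (∀ {t} → t < l + a → f t ≡ h t) → window f a l ≡ window h a l
window-cong-≤ a zero    _  = refl
window-cong-≤ a (suc l) eq = cong₂ _+_ (eq (s≤s (m≤n+m a l)))
  (window-cong-≤ (suc a) l (λ {t} t< → eq (subst (t <_) (+-suc l a) t<)))

shift-window : ∀ (f : ℕ → ℕ → ℕ) l s →
               shift 1 (λ s → window (λ k → f k s) 0 l) s ≡ window (λ k → shift 1 (f k) s) 0 l
shift-window f l zero    = sym (window-zero 0 l (λ _ → refl))
shift-window f l (suc s) = refl

count-all : {P : A → Set} (P? : Decidable P) → (∀ x → does (P? x) ≡ true) → ∀ xs → count P? xs ≡ length xs
count-all P? all []       = refl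
count-all P? all (x ∷ xs) = trans (count-∷ P? x xs)
  (cong₂ _+_ (cong (λ b → if b then 1 else 0) (all x)) (count-all P? all xs))

count-none : {P : A → Set} (P? : Decidable P) → (∀ x → does (P? x) ≡ false) → ∀ xs → count P? xs ≡ 0
count-none P? none []       = refl
count-none P? none (x ∷ xs) = trans (count-∷ P? x xs)
  (cong₂ _+_ (cong (λ b → if b then 1 else 0) (none x)) (count-none P? none xs))

count-cong : {P Q : A → Set} (P? : Decidable P) (Q? : Decidable Q) →
             (∀ x → does (P? x) ≡ does (Q? x)) → ∀ xs → count P? xs ≡ count Q? xs
count-cong P? Q? eq []       = refl
count-cong P? Q? eq (x ∷ xs) = trans (count-∷ P? x xs) (trans
  (cong₂ _+_ (cong (λ b → if b then 1 else 0) (eq x)) (count-cong P? Q? eq xs)) (sym (count-∷ Q? x xs)))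

count-vectors : ∀ {n} {P : Vec A (suc n) → Set} (P? : Decidable P) {c} {V} {xs : List A} →
  All (λ a → count (λ v → P? (a ∷ v)) V ≡ c) xs →
  count P? (cartesianProductWith _∷_ xs V) ≡ length xs * c
count-vectors P?         []         = refl
count-vectors P? {V = V} {a ∷ xs} (eq ∷ eqs) = trans (count-++ P? (map (a ∷_) V) _)
  (cong₂ _+_ (trans (count-map P? (a ∷_) V) eq) (count-vectors P? eqs))

length-vectors : ∀ (xs : List A) n → length (vectors xs n) ≡ length xs ^ n
length-vectors xs zero    = refl
length-vectors xs (suc n) = trans (sym (count-all (λ _ → yes tt) (λ _ → refl) (vectors xs (suc n))))
  (count-vectors (λ _ → yes tt) {length xs ^ n} {vectors xs n} {xs} (All.tabulate (λ _ →
    trans (count-all (λ _ → yes tt) (λ _ → refl) (vectors xs n)) (length-vectors xs n))))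

-- Vectors are classified by the position `k ≤ j` of their first zero: the `k` coordinates before it
-- have `m` choices each, the `d ∸ k` coordinates after it have `suc m`, and the product is
-- `F d k m`.
multichains-boundaryJoin : ∀ {d j} → j ≤ d → ∀ m →
  multichains (boundaryJoin d j) m ≡ window (λ k → F d k m) 0 (suc j)
multichains-boundaryJoin {d} {j} j≤d m = begin
  count P? (map (0 ∷_) V ++ cartesianProductWith _∷_ (applyUpTo suc m) V)
    ≡⟨ count-++ P? (map (0 ∷_) V) _ ⟩
  count P? (map (0 ∷_) V) + count P? (cartesianProductWith _∷_ (applyUpTo suc m) V)
    ≡⟨ cong₂ _+_ zeros (positive j≤d) ⟩
  F d 0 m + window (λ k → F d k m) 1 j ∎
  where
  open ≡-Reasoning
  V : List (Vec ℕ d)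
  V = vectors (upTo (suc m)) d
  P? : Decidable (λ v → Avoids j (support v))
  P? v = avoids? j (support v)
  zeros : count P? (map (0 ∷_) V) ≡ F d 0 m
  zeros = begin
    count P? (map (0 ∷_) V)              ≡⟨ count-map P? (0 ∷_) V ⟩
    count (λ v → P? (0 ∷ v)) V           ≡⟨ count-all (λ v → P? (0 ∷ v)) (λ _ → refl) V ⟩
    length V                             ≡⟨ length-vectors (upTo (suc m)) d ⟩
    length (upTo (suc m)) ^ d            ≡⟨ cong (_^ d) (length-upTo (suc m)) ⟩
    suc m ^ d                            ≡⟨ *-identityˡ (suc m ^ d) ⟨
    F d 0 m                              ∎
  positive : ∀ {d j} → j ≤ d →
    count (λ v → avoids? j (support v)) (cartesianProductWith _∷_ (applyUpTo suc m) (vectors (upTo (suc m)) d)) ≡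
    window (λ k → F d k m) 1 j
  positive {d} z≤n = trans (count-vectors _ {0} {vectors (upTo (suc m)) d} {applyUpTo suc m}
    (All.applyUpTo⁺₂ suc m (λ a → count-none (λ v → avoids? 0 (support (suc a ∷ v))) (λ _ → refl) (vectors (upTo (suc m)) d))))
    (*-zeroʳ (length (applyUpTo suc m)))
  positive {suc d} {suc j} (s≤s j≤d) = begin
    count (λ v → avoids? (suc j) (support v)) (cartesianProductWith _∷_ (applyUpTo suc m) (vectors (upTo (suc m)) (suc d)))
      ≡⟨ count-vectors (λ v → avoids? (suc j) (support v)) (All.applyUpTo⁺₂ suc m (λ a →
           trans (count-cong (λ v → avoids? (suc j) (support (suc a ∷ v))) (λ v → avoids? j (support v))
                   (λ _ → refl) (vectors (upTo (suc m)) (suc d)))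
                 (multichains-boundaryJoin j≤d m))) ⟩
    length (applyUpTo suc m) * window (λ k → F d k m) 0 (suc j)
      ≡⟨ cong (_* window (λ k → F d k m) 0 (suc j)) (length-applyUpTo suc m) ⟩
    m * window (λ k → F d k m) 0 (suc j)
      ≡⟨ window-* m (λ k → F d k m) 0 (suc j) ⟨
    window (λ k → m * F d k m) 0 (suc j)
      ≡⟨ window-cong (λ k → sym (*-assoc m (m ^ k) (suc m ^ (d ∸ k)))) 0 (suc j) ⟩
    window (λ k → F (suc d) (suc k) m) 0 (suc j)
      ≡⟨ window-∘suc (λ k → F (suc d) k m) 0 (suc j) ⟨
    window (λ k → F (suc d) k m) 1 (suc j) ∎

diff-weakCompositions : ∀ g → diff g (fromℕ ∘ length ∘ weakCompositions g) ≗ 1ₚ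
diff-weakCompositions zero    zero    = refl
diff-weakCompositions zero    (suc k) = refl
diff-weakCompositions (suc g) k       =
  trans (diff-cong g ([1-x]·-shift recurrence) k) (diff-weakCompositions g k)
  where
  recurrence : ∀ n → length (weakCompositions (suc g) n) ≡
               shift 1 (length ∘ weakCompositions (suc g)) n + length (weakCompositions g n)
  recurrence zero    = length-map (0 ∷_) (weakCompositions g 0)
  recurrence (suc n) = trans (length-++ (map (0 ∷_) (weakCompositions g (suc n))))
    (trans (cong₂ _+_ (length-map (0 ∷_) (weakCompositions g (suc n))) (length-map increment (weakCompositions (suc g) n)))
           (+-comm (length (weakCompositions g (suc n))) _))

-- Induction on `j` by the first entry: if it is zero, the tail is arbitrary and contributes 1; if
-- it is positive, the smaller complex is met again, with an additional factor x.
diff-boundaryJoin : ∀ {d j} → j ≤ d → ∀ k →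
  diff d (fromℕ ∘ multisets (boundaryJoin d j)) k ≡ fromℕ (if k <ᵇ suc j then 1 else 0)
diff-boundaryJoin {d} z≤n k = trans (diff-cong d (λ n → cong fromℕ (only-zeros n)) k)
  (trans (diff-weakCompositions d k) (1ₚ-indicator k))
  where
  1ₚ-indicator : ∀ k → 1ₚ k ≡ fromℕ (if k <ᵇ 1 then 1 else 0)
  1ₚ-indicator zero    = refl
  1ₚ-indicator (suc k) = refl
  P? : Decidable (λ (v : Vec ℕ (suc d)) → Avoids 0 (support v))
  P? v = avoids? 0 (support v)
  zeros : ∀ n → count P? (map (0 ∷_) (weakCompositions d n)) ≡ length (weakCompositions d n)
  zeros n = trans (count-map P? (0 ∷_) (weakCompositions d n))
    (count-all (λ v → P? (0 ∷ v)) (λ _ → refl) (weakCompositions d n))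
  only-zeros : ∀ n → multisets (boundaryJoin d 0) n ≡ length (weakCompositions d n)
  only-zeros zero    = zeros 0
  only-zeros (suc n) = begin
    count P? (map (0 ∷_) (weakCompositions d (suc n)) ++ map increment (weakCompositions (suc d) n))
      ≡⟨ count-++ P? (map (0 ∷_) (weakCompositions d (suc n))) _ ⟩
    _ ≡⟨ cong₂ _+_ (zeros (suc n)) (trans (count-map P? increment (weakCompositions (suc d) n))
           (count-none (λ v → P? (increment v)) (λ _ → refl) (weakCompositions (suc d) n))) ⟩
    length (weakCompositions d (suc n)) + 0
      ≡⟨ +-identityʳ _ ⟩
    length (weakCompositions d (suc n)) ∎
    where open ≡-Reasoning
diff-boundaryJoin {suc d} {suc j} (s≤s j≤d) k = begin
  diff (suc d) (fromℕ ∘ multisets (boundaryJoin (suc d) (suc j))) k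
    ≡⟨ diff-cong (suc d) (λ n → trans (cong fromℕ (split n)) (fromℕ-+ (a n) (shift 1 T n))) k ⟩
  diff (suc d) (λ n → fromℕ (a n) ℚ.+ fromℕ (shift 1 T n)) k
    ≡⟨ diff-+ (suc d) (fromℕ ∘ a) (fromℕ ∘ shift 1 T) k ⟩
  diff (suc d) (fromℕ ∘ a) k ℚ.+ diff (suc d) (fromℕ ∘ shift 1 T) k
    ≡⟨ cong₂ ℚ._+_ (diff-weakCompositions (suc d) k) T-part ⟩
  1ₚ k ℚ.+ (x· (λ k → fromℕ (if k <ᵇ suc j then 1 else 0))) k
    ≡⟨ combine k ⟩
  fromℕ (if k <ᵇ suc (suc j) then 1 else 0) ∎
  where
  open ≡-Reasoning
  a T : ℕ → ℕ
  a n = length (weakCompositions (suc d) n)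
  P? : Decidable (λ (v : Vec ℕ (suc (suc d))) → Avoids (suc j) (support v))
  P? v = avoids? (suc j) (support v)
  tail? : Decidable (λ (v : Vec ℕ (suc (suc d))) → Avoids j (support (tail v)))
  tail? v = avoids? j (support (tail v))
  -- The first entry is free here, so this is the series of the smaller complex divided by `1 - x`;
  -- a positive first entry corresponds to `shift 1 T`.
  T n = count tail? (weakCompositions (suc (suc d)) n)
  zeros : ∀ n → count P? (map (0 ∷_) (weakCompositions (suc d) n)) ≡ a n
  zeros n = trans (count-map P? (0 ∷_) (weakCompositions (suc d) n))
    (count-all (λ v → P? (0 ∷ v)) (λ _ → refl) (weakCompositions (suc d) n))
  split : ∀ n → multisets (boundaryJoin (suc d) (suc j)) n ≡ a n + shift 1 T n
  split zero    = trans (zeros 0) (sym (+-identityʳ _))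
  split (suc n) = trans (count-++ P? (map (0 ∷_) (weakCompositions (suc d) (suc n))) _)
    (cong₂ _+_ (zeros (suc n)) (trans (count-map P? increment (weakCompositions (suc (suc d)) n))
      (count-cong (λ v → P? (increment v)) tail? (λ _ → refl) (weakCompositions (suc (suc d)) n))))
  T-recurrence : ∀ n → T n ≡ shift 1 T n + multisets (boundaryJoin d j) n
  T-recurrence zero    = count-map tail? (0 ∷_) (weakCompositions (suc d) 0)
  T-recurrence (suc n) = trans (count-++ tail? (map (0 ∷_) (weakCompositions (suc d) (suc n))) _)
    (trans (cong₂ _+_ (count-map tail? (0 ∷_) (weakCompositions (suc d) (suc n)))
                      (count-map tail? increment (weakCompositions (suc (suc d)) n)))
           (+-comm (multisets (boundaryJoin d j) (suc n)) (T n)))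
  T-part : diff (suc d) (fromℕ ∘ shift 1 T) k ≡ (x· (λ k → fromℕ (if k <ᵇ suc j then 1 else 0))) k
  T-part = begin
    diff (suc d) (fromℕ ∘ shift 1 T) k
      ≡⟨ diff-cong (suc d) (fromℕ-shift T) k ⟩
    diff (suc d) (x· (fromℕ ∘ T)) k
      ≡⟨ diff-x (suc d) (fromℕ ∘ T) k ⟩
    (x· (diff d ([1-x]· (fromℕ ∘ T)))) k
      ≡⟨ x·-cong (λ k → trans (diff-cong d ([1-x]·-shift T-recurrence) k) (diff-boundaryJoin j≤d k)) k ⟩
    (x· (λ k → fromℕ (if k <ᵇ suc j then 1 else 0))) k ∎
  combine : ∀ k → 1ₚ k ℚ.+ (x· (λ k → fromℕ (if k <ᵇ suc j then 1 else 0))) k ≡ fromℕ (if k <ᵇ suc (suc j) then 1 else 0)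
  combine zero    = refl
  combine (suc k) = ℚ.+-identityˡ _

-- Columns of the transformation matrix

-- The entry of H in row n and column j, for complexes of dimension d (not d - 1).
entry : (r d : ℕ) → ℕ → ℕ → ℕ
entry r d j n = window (λ τ → C r d τ n) j (suc d)

-- The recurrence `multisets-sd` determines its last term by cancellation, so it suffices to write
-- the series of multichains as its own shift plus windows of `Φ d`, one window for each summand
-- `F (suc d) k`.
multisets-coloredSd : ∀ r d {j} → j ≤ suc d → ∀ n →
  multisets (coloredSd r (boundaryJoin (suc d) j)) n ≡
  window (λ k → window (λ τ → Φ d τ (r * n)) k (suc d)) 0 (suc j)
multisets-coloredSd r d {j} j≤1+d n = trans (multisets-esd r (sd Δ) n) (+-cancelˡ-≡ (shift 1 W (r * n)) _ _ (begin
  shift 1 W (r * n) + multisets (sd Δ) (r * n)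
    ≡⟨ multisets-sd Δ (r * n) ⟨
  W (r * n)
    ≡⟨ multichains-boundaryJoin j≤1+d (r * n) ⟩
  window (λ k → F (suc d) k (r * n)) 0 (suc j)
    ≡⟨ window-cong-≤ 0 (suc j) (λ {k} k< → F-window k
         (≤-trans (s≤s⁻¹ (subst (k <_) (+-identityʳ (suc j)) k<)) j≤1+d) (r * n)) ⟩
  window (λ k → shift 1 (F (suc d) k) (r * n) + D k) 0 (suc j)
    ≡⟨ window-+ (λ k → shift 1 (F (suc d) k) (r * n)) D 0 (suc j) ⟩
  window (λ k → shift 1 (F (suc d) k) (r * n)) 0 (suc j) + window D 0 (suc j)
    ≡⟨ cong (_+ window D 0 (suc j)) (shift-window (F (suc d)) (suc j) (r * n)) ⟨
  shift 1 (λ s → window (λ k → F (suc d) k s) 0 (suc j)) (r * n) + window D 0 (suc j)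
    ≡⟨ cong (_+ window D 0 (suc j)) (shift-cong 1 (multichains-boundaryJoin j≤1+d) (r * n)) ⟨
  shift 1 W (r * n) + window D 0 (suc j) ∎))
  where
  open ≡-Reasoning
  Δ : SimplicialComplex
  Δ = boundaryJoin (suc d) j
  W D : ℕ → ℕ
  W = multichains Δ
  D k = window (λ τ → Φ d τ (r * n)) k (suc d)
  -- Telescoping over a single period; this is the origin of the window length `suc d` in `entry`.
  F-window : ∀ k → k ≤ suc d → ∀ s → F (suc d) k s ≡ shift 1 (F (suc d) k) s + window (λ τ → Φ d τ s) k (suc d)
  F-window k k≤ s = begin
    F (suc d) k s                                              ≡⟨ Ψ≡F s ⟨
    Ψ d k s                                                    ≡⟨ Ψ-window d 1 k s ⟩
    shift 1 (Ψ d k) s + window (λ τ → Φ d τ s) k (1 * suc d)   ≡⟨ cong₂ _+_ (shift-cong 1 Ψ≡F s)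
                                                                     (cong (window (λ τ → Φ d τ s) k) (*-identityˡ (suc d))) ⟩
    shift 1 (F (suc d) k) s + window (λ τ → Φ d τ s) k (suc d) ∎
    where
    Ψ≡F : ∀ s → Ψ d k s ≡ F (suc d) k s
    Ψ≡F s = trans (cong (λ τ → Ψ d τ s) (sym (+-identityʳ k))) (Ψ-at 0 k≤ s)

-- The pairing of a row with the h-vector of a test complex, whose first `m` entries are 1 and the
-- others 0.
prefix : ∀ {n} → Vector ℚ n → ℕ → ℚ
prefix v m = ∑ λ k → v k ℚ.* fromℕ (if toℕ k <ᵇ m then 1 else 0)

prefix-zero : ∀ {n} (v : Vector ℚ n) → prefix v 0 ≡ 0ℚ
prefix-zero {n} v = ∑-zero {n} (λ k → ℚ.*-zeroʳ (v k))

prefix-suc : ∀ {n} (v : Vector ℚ n) j → prefix v (suc (toℕ j)) ≡ prefix v (toℕ j) ℚ.+ v j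
prefix-suc {suc n} v Fin.zero = begin
  v Fin.zero ℚ.* 1ℚ ℚ.+ prefix (v ∘ Fin.suc) 0               ≡⟨ cong₂ ℚ._+_ (ℚ.*-identityʳ (v Fin.zero)) (prefix-zero (v ∘ Fin.suc)) ⟩
  v Fin.zero ℚ.+ 0ℚ                                          ≡⟨ ℚ.+-comm (v Fin.zero) 0ℚ ⟩
  0ℚ ℚ.+ v Fin.zero                                          ≡⟨ cong (ℚ._+ v Fin.zero) (prefix-zero v) ⟨
  prefix v 0 ℚ.+ v Fin.zero                                  ∎
  where open ≡-Reasoning
prefix-suc {suc n} v (Fin.suc j) = trans
  (cong (v Fin.zero ℚ.* 1ℚ ℚ.+_) (prefix-suc (v ∘ Fin.suc) j)) (sym (ℚ.+-assoc (v Fin.zero ℚ.* 1ℚ) _ _))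

module _ {r d : ℕ} .{{_ : NonZero r}} (H : Matrix (suc (suc d)) (suc (suc d)))
         (trans-H : IsTransformationMatrix (suc d) r H) where

  private
    column-sums : ∀ i j → j ≤ suc d → prefix (H i) (suc j) ≡ fromℕ (window (λ k → entry r d k (toℕ i)) 0 (suc j))
    column-sums i j j≤ = begin
      prefix (H i) (suc j)
        ≡⟨ ∑-cong {suc (suc d)} (λ k → cong (H i k ℚ.*_) (trans (hVector-multisets (suc d) Δ k) (diff-boundaryJoin j≤ (toℕ k)))) ⟨
      (H *ᵥ hVector (suc d) Δ) i
        ≡⟨ trans-H Δ (boundaryJoin-dim (suc d) j) i ⟨
      hVector (suc d) (coloredSd r Δ) i
        ≡⟨ hVector-multisets (suc d) (coloredSd r Δ) i ⟩
      diff (suc d) (fromℕ ∘ multisets (coloredSd r Δ)) (toℕ i)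
        ≡⟨ diff-cong (suc d) (λ n → cong fromℕ (multisets-coloredSd r d j≤ n)) (toℕ i) ⟩
      diff (suc d) (λ n → fromℕ (window (λ k → window (λ τ → Φ d τ (r * n)) k (suc d)) 0 (suc j))) (toℕ i)
        ≡⟨ diff-window (suc d) {λ k n → window (λ τ → Φ d τ (r * n)) k (suc d)} {entry r d}
             (λ k → diff-window (suc d) {λ τ n → Φ d τ (r * n)} {C r d} (diff-Φ r d) k (suc d)) 0 (suc j) (toℕ i) ⟩
      fromℕ (window (λ k → entry r d k (toℕ i)) 0 (suc j)) ∎
      where
      open ≡-Reasoning
      Δ : SimplicialComplex
      Δ = boundaryJoin (suc d) j

    prefixes : ∀ i m → m ≤ suc (suc d) → prefix (H i) m ≡ fromℕ (window (λ k → entry r d k (toℕ i)) 0 m)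
    prefixes i zero    _   = prefix-zero (H i)
    prefixes i (suc j) j<  = column-sums i j (s≤s⁻¹ j<)

  -- A column is the difference of consecutive prefix sums, obtained here by cancelling the shorter
  -- one.
  H≡entry : ∀ i j → H i j ≡ fromℕ (entry r d (toℕ j) (toℕ i))
  H≡entry i j = ∙-cancelˡ (fromℕ (w (toℕ j))) _ _ (begin
    fromℕ (w (toℕ j)) ℚ.+ H i j                    ≡⟨ cong (ℚ._+ H i j) (prefixes i (toℕ j) (<⇒≤ (toℕ<n j))) ⟨
    prefix (H i) (toℕ j) ℚ.+ H i j                 ≡⟨ prefix-suc (H i) j ⟨
    prefix (H i) (suc (toℕ j))                     ≡⟨ prefixes i (suc (toℕ j)) (toℕ<n j) ⟩
    fromℕ (w (suc (toℕ j)))                        ≡⟨ cong fromℕ (window-0-suc (λ k → entry r d k (toℕ i)) (toℕ j)) ⟩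
    fromℕ (w (toℕ j) + entry r d (toℕ j) (toℕ i))  ≡⟨ fromℕ-+ (w (toℕ j)) _ ⟩
    fromℕ (w (toℕ j)) ℚ.+ fromℕ (entry r d (toℕ j) (toℕ i)) ∎)
    where
    open ≡-Reasoning
    w : ℕ → ℕ
    w = window (λ k → entry r d k (toℕ i)) 0

corollary5p7 : (d r : ℕ) → 1 ≤ d → 1 ≤ r →
    (H : Matrix (suc d) (suc d)) → IsTransformationMatrix d r H → TP₂ H
corollary5p7 (suc d) r@(suc _) _ _ H trans-H = record { entries = entries ; minors = minors }
  where
  H≡ : ∀ i j → H i j ≡ fromℕ (entry r d (toℕ j) (toℕ i))
  H≡ = H≡entry {r} {d} H trans-H
  entries : ∀ i j → 0ℚ ℚ.≤ H i j
  entries i j = subst (0ℚ ℚ.≤_) (sym (H≡ i j)) (fromℕ-mono-≤ {0} {entry r d (toℕ j) (toℕ i)} z≤n)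
  minors : ∀ {i i′ j j′} → i Fin.< i′ → j Fin.< j′ → 0ℚ ℚ.≤ H i j ℚ.* H i′ j′ ℚ.- H i j′ ℚ.* H i′ j
  minors {i} {i′} {j} {j′} i<i′ j<j′ = p≤q⇒0≤q-p (subst₂ ℚ._≤_ (product i j′ i′ j) (product i j i′ j′)
    (fromℕ-mono-≤ minor))
    where
    minor : entry r d (toℕ j′) (toℕ i) * entry r d (toℕ j) (toℕ i′) ≤
            entry r d (toℕ j) (toℕ i) * entry r d (toℕ j′) (toℕ i′)
    -- The columns `j` and `j′` are windows of the common length `suc d` with left ends `j` and
    -- `j′`, so one more window sum carries the minors of the list over to `H`.
    minor = window-ratioMonotone {λ τ → C r d τ (toℕ i)} {λ τ → C r d τ (toℕ i′)}
              (C-ratioMonotone r d i<i′) (suc d) (<⇒≤ j<j′)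
    p≤q⇒0≤q-p : ∀ {p q} → p ℚ.≤ q → 0ℚ ℚ.≤ q ℚ.- p
    p≤q⇒0≤q-p {p} {q} p≤q = subst (ℚ._≤ q ℚ.- p) (ℚ.+-inverseʳ p) (ℚ.+-monoˡ-≤ (ℚ.- p) p≤q)
    product : ∀ i j i′ j′ → fromℕ (entry r d (toℕ j) (toℕ i) * entry r d (toℕ j′) (toℕ i′)) ≡ H i j ℚ.* H i′ j′
    product i j i′ j′ = trans (fromℕ-* (entry r d (toℕ j) (toℕ i)) (entry r d (toℕ j′) (toℕ i′)))
                              (sym (cong₂ ℚ._*_ (H≡ i j) (H≡ i′ j′)))
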